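{- (i) Let $n\ge 5$ be odd and $\frac{n+1}{2}\le p\le n-2$. Put $r=\sum_{i=0}^{p-\frac{n-1}{2}}\binom{n}{i}$ and $s=\binom{p}{p-\frac{n-1}{2}}$. Then $b(Q_n^p)\le 2^{n-1}+\left\lfloor\frac{r-s}{2}\right\rfloor$. (ii) Let $n\ge 6$ be even and $\frac{n}{2}+1\le p\le n-2$. Put $r'=\sum_{i=0}^{p-\frac{n}{2}}\binom{n}{i}+\binom{n-1}{p-\frac{n}{2}}$ and $s'=\binom{p-1}{p-\frac{n}{2}}$. Then $b(Q_n^p)\le 2^{n-1}+\left\lfloor\frac{r'-s'}{2}\right\rfloor$.
   Context: The hypercube $Q_n$ has vertex set the power set $2^{[n]}$ of $[n]=\{1,\dots,n\}$, with $x,y$ adjacent iff $|x\triangle y|=1$. The $p$-th power $Q_n^p$ has the same vertex set, with distinct $x,y$ adjacent iff $|x\triangle y|\le p$. A b-coloring of a graph $G$ with $k$ colors is a proper vertex coloring with $k$ colors in which every color class contains a vertex adjacent to at least one vertex of every other color class; the b-chromatic number $b(G)$ is the largest $k$ for which $G$ has a b-coloring with $k$ colors. -}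

module Defs where

open import Data.Nat using (ℕ; _≤_)
open import Data.Fin using (Fin)
open import Data.Fin.Subset using (Subset; _∪_; _─_; ∣_∣)
open import Data.List using (map; upTo)
open import Data.Nat.ListAction using (sum)
open import Data.Product using (∃; _×_)
open import Relation.Binary.PropositionalEquality using (_≡_; _≢_)

record Graph (V : Set) : Set₁ where
  field
    Adj : V → V → Set

open Graph public

_△_ : ∀ {n} → Subset n → Subset n → Subset n
x △ y = (x ─ y) ∪ (y ─ x)

QPow : (n p : ℕ) → Graph (Subset n)
QPow n p = record { Adj = λ x y → x ≢ y × ∣ x △ y ∣ ≤ p }

IsProper : ∀ {V} → Graph V → (k : ℕ) → (V → Fin k) → Set
IsProper G k c = ∀ u v → Adj G u v → c u ≢ c v

IsBColoring : ∀ {V} → Graph V → (k : ℕ) → (V → Fin k) → Set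
IsBColoring G k c =
  IsProper G k c ×
  (∀ (i : Fin k) → ∃ λ v → c v ≡ i ×
     (∀ (j : Fin k) → j ≢ i → ∃ λ u → Adj G v u × c u ≡ j))

bChromatic≤ : ∀ {V} → Graph V → ℕ → Set
bChromatic≤ {V} G B = ∀ (k : ℕ) (c : V → Fin k) → IsBColoring G k c → k ≤ B

Σ0to : ℕ → (ℕ → ℕ) → ℕ
Σ0to m f = sum (map f (upTo (Data.Nat.suc m)))

{-# OPTIONS --safe #-}
module Submission where

-- Let A be the set of vertices whose colour class is a singleton, and S the set of vertices at distance at
-- most p from every vertex of A. A b-vertex of any class lies in S, so k ≤ ∣S∣, while counting class sizes gives
-- 2k ≤ 2ⁿ + ∣A∣. It remains to show that ∣A∣ > r - s forces ∣S∣ ≤ 2ⁿ⁻¹ + ⌊(r - s)/2⌋. Compressions in the style of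
-- Frankl and Füredi's proof of Harper's theorem make both families contain, with each set, all smaller sets, and
-- make them shifted, without increasing the distances. Then A contains all sets below some level τ and misses few
-- sets of size τ. The complements of the largest members of S have all their τ-subsets among the missing ones, so
-- Kruskal-Katona bounds their number.

open import Defs
open import Data.Bool using (Bool; true; false; not; _∧_; _∨_; _xor_; if_then_else_)
import Data.Bool.Properties as Bool
open import Data.Fin using (Fin; zero; suc)
import Data.Fin.Properties as Fin
open import Data.Fin.Subset using (Subset; ∣_∣; ∁; ⊥)
open import Data.Fin.Subset.Properties using (anySubset?)
open import Data.List using (map; upTo; _∷ʳ_)
open import Data.List.Properties using (upTo-∷ʳ; map-++)
open import Data.Nat
open import Data.Nat.Combinatorics using (_C_; k>n⇒nCk≡0; nCk+nC[k+1]≡[n+1]C[k+1]; nCk≡nC[n∸k])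
open import Data.Nat.Divisibility using (n∣m*n)
open import Data.Nat.DivMod using (m*n/n≡m; /-monoˡ-≤; +-distrib-/-∣ˡ; m≡m%n+[m/n]*n)
open import Data.Nat.Induction using (<-wellFounded)
open import Data.Nat.ListAction using (sum)
open import Data.Nat.ListAction.Properties using (sum-++)
open import Data.Nat.Properties
open import Data.Nat.Tactic.RingSolver using (solve-∀)
open import Data.Product using (∃; _×_; _,_; proj₁; proj₂)
open import Data.Sum using (_⊎_; inj₁; inj₂)
open import Data.Unit using (tt)
open import Data.Vec using ([]; _∷_)
import Data.Vec.Properties as Vec
open import Function using (_∘_)
open import Induction.WellFounded using (Acc; acc)
open import Relation.Binary.PropositionalEquality
open import Relation.Nullary
open import Relation.Nullary.Decidable using (dec-true; dec-false)
open import Algebra.Properties.CommutativeSemigroup +-commutativeSemigroup using (interchange; x∙yz≈y∙xz)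

-- The constants rest on a symmetry of binomials. Let `t` be the upper limit of the sum. For n = 2q
-- + 1 and p = q + t, a normalised family with more than r - s members misses fewer than s = C(q+t,
-- t) sets of size t; Kruskal-Katona turns this into fewer than C(q+t, q) extra sets on the other
-- side, which is s again. For n = 2q + 2 and p = q + t + 1, the term C(n-1, t) of r' counts the
-- (t+1)-sets through a fixed element. Fewer than C(n-1, t+1) + s' sets can then be missing, so the
-- shadow theorem must treat sums of two binomials; the image C(n-1, q+1) + s' is half the middle
-- layer plus s'. Both cases close if 3s ≤ r + 2, which fails for odd n and t = 1, where another
-- cascade is taken. Compressing two families together meets an obstacle: a set that moves may drift
-- away from one that stays. A smaller member of the other family then bounds the distance. This is
-- why violations are removed in the order of their distance, and why sets of equal size are
-- compared only when they differ by a single replacement.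

-- With d the slack, the remaining equation is a semiring identity.
linear : ∀ {x y} l r d → x ≤ y → l + y + d ≡ r + x → l ≤ r
linear {x} {y} l r d x≤y eq = +-cancelʳ-≤ x l r (begin
  l + x      ≤⟨ +-monoʳ-≤ l x≤y ⟩
  l + y      ≤⟨ m≤m+n (l + y) d ⟩
  l + y + d  ≡⟨ eq ⟩
  r + x      ∎) where open ≤-Reasoning

-- Sums and cardinalities over the cube

⟦_⟧ : Bool → ℕ
⟦ true ⟧  = 1
⟦ false ⟧ = 0

∑ : ∀ {n} → (Subset n → ℕ) → ℕ
∑ {zero}  h = h []
∑ {suc n} h = ∑ (h ∘ (true ∷_)) + ∑ (h ∘ (false ∷_))

# : ∀ {n} → (Subset n → Bool) → ℕ
# f = ∑ (⟦_⟧ ∘ f)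

∑-mono : ∀ {n} {h k : Subset n → ℕ} → (∀ x → h x ≤ k x) → ∑ h ≤ ∑ k
∑-mono {zero}  h≤k = h≤k []
∑-mono {suc n} h≤k = +-mono-≤ (∑-mono (h≤k ∘ (true ∷_))) (∑-mono (h≤k ∘ (false ∷_)))

∑-cong : ∀ {n} {h k : Subset n → ℕ} → (∀ x → h x ≡ k x) → ∑ h ≡ ∑ k
∑-cong h≡k = ≤-antisym (∑-mono (≤-reflexive ∘ h≡k)) (∑-mono (≤-reflexive ∘ sym ∘ h≡k))

∑-+ : ∀ {n} (h k : Subset n → ℕ) → ∑ (λ x → h x + k x) ≡ ∑ h + ∑ k
∑-+ {zero}  h k = refl
∑-+ {suc n} h k = trans
  (cong₂ _+_ (∑-+ (h ∘ (true ∷_)) (k ∘ (true ∷_))) (∑-+ (h ∘ (false ∷_)) (k ∘ (false ∷_))))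
  (interchange (∑ (h ∘ (true ∷_))) _ _ _)

∑-0 : ∀ n → ∑ {n} (λ _ → 0) ≡ 0
∑-0 zero    = refl
∑-0 (suc n) = cong₂ _+_ (∑-0 n) (∑-0 n)

∑-1 : ∀ n → ∑ {n} (λ _ → 1) ≡ 2 ^ n
∑-1 zero    = refl
∑-1 (suc n) = cong₂ _+_ (∑-1 n) (trans (∑-1 n) (sym (+-identityʳ (2 ^ n))))

point≤∑ : ∀ {n} (h : Subset n → ℕ) x → h x ≤ ∑ h
point≤∑ {zero}  h []          = ≤-refl
point≤∑ {suc n} h (true ∷ x)  = ≤-trans (point≤∑ (h ∘ (true ∷_)) x) (m≤m+n _ _)
point≤∑ {suc n} h (false ∷ x) = ≤-trans (point≤∑ (h ∘ (false ∷_)) x) (m≤n+m _ _)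

points≤∑ : ∀ {n} (h : Subset n → ℕ) x y → x ≢ y → h x + h y ≤ ∑ h
points≤∑ {zero}  h [] [] x≢y = contradiction refl x≢y
points≤∑ {suc n} h (true ∷ x) (true ∷ y) x≢y =
  ≤-trans (points≤∑ (h ∘ (true ∷_)) x y (x≢y ∘ cong (true ∷_))) (m≤m+n _ _)
points≤∑ {suc n} h (true ∷ x) (false ∷ y) x≢y = +-mono-≤ (point≤∑ (h ∘ (true ∷_)) x) (point≤∑ (h ∘ (false ∷_)) y)
points≤∑ {suc n} h (false ∷ x) (true ∷ y) x≢y = ≤-trans (≤-reflexive (+-comm (h (false ∷ x)) _))
  (+-mono-≤ (point≤∑ (h ∘ (true ∷_)) y) (point≤∑ (h ∘ (false ∷_)) x))
points≤∑ {suc n} h (false ∷ x) (false ∷ y) x≢y =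
  ≤-trans (points≤∑ (h ∘ (false ∷_)) x y (x≢y ∘ cong (false ∷_))) (m≤n+m _ _)

∑-mono-< : ∀ {n} {h k : Subset n → ℕ} → (∀ x → h x ≤ k x) → ∀ x → h x < k x → ∑ h < ∑ k
∑-mono-< h≤k [] h<k = h<k
∑-mono-< h≤k (true ∷ x) h<k =
  +-mono-<-≤ (∑-mono-< (h≤k ∘ (true ∷_)) x h<k) (∑-mono (h≤k ∘ (false ∷_)))
∑-mono-< h≤k (false ∷ x) h<k =
  +-mono-≤-< (∑-mono (h≤k ∘ (true ∷_))) (∑-mono-< (h≤k ∘ (false ∷_)) x h<k)

⟦⟧-mono : ∀ {a b} → (a ≡ true → b ≡ true) → ⟦ a ⟧ ≤ ⟦ b ⟧
⟦⟧-mono {false} _   = z≤n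
⟦⟧-mono {true}  imp rewrite imp refl = ≤-refl

#-mono : ∀ {n} {f g : Subset n → Bool} → (∀ x → f x ≡ true → g x ≡ true) → # f ≤ # g
#-mono f⊆g = ∑-mono (λ x → ⟦⟧-mono (f⊆g x))

#-positive : ∀ {n} (f : Subset n → Bool) x → f x ≡ true → 1 ≤ # f
#-positive f x fx = ≤-trans (≤-reflexive (sym (cong ⟦_⟧ fx))) (point≤∑ (⟦_⟧ ∘ f) x)

#-nonempty : ∀ {n} (f : Subset n → Bool) → 1 ≤ # f → ∃ λ x → f x ≡ true
#-nonempty {zero} f 1≤ with f [] in eq
... | true = [] , eq
#-nonempty {suc n} f 1≤ with # (f ∘ (true ∷_)) in eq
... | suc _ = let x , fx = #-nonempty (f ∘ (true ∷_)) (≤-trans (s≤s z≤n) (≤-reflexive (sym eq))) in true ∷ x , fx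
... | zero  = let x , fx = #-nonempty (f ∘ (false ∷_)) 1≤ in false ∷ x , fx

-- Sizes, positions and distances

-- Cardinality, position sum and the weight that makes compression terminate are all additive over
-- elements, so facts about swaps and complements are proved once for all of them.
weigh : (ℕ → ℕ) → ∀ {n} → Subset n → ℕ
weigh ω []              = 0
weigh ω {suc n} (a ∷ x) = (if a then ω n else 0) + weigh ω x

size : ∀ {n} → Subset n → ℕ
size = weigh (λ _ → 1)

-- The earlier an element, the larger its position: the head of a vector of length suc n has position n.
pos : ∀ {n} → Subset n → ℕ
pos = weigh (λ i → i)

dist : ∀ {n} → Subset n → Subset n → ℕ
dist [] []           = 0
dist (a ∷ x) (b ∷ y) = ⟦ a xor b ⟧ + dist x y

dist≡∣△∣ : ∀ {n} (x y : Subset n) → dist x y ≡ ∣ x △ y ∣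
dist≡∣△∣ [] [] = refl
dist≡∣△∣ (true ∷ x)  (true ∷ y)  = dist≡∣△∣ x y
dist≡∣△∣ (true ∷ x)  (false ∷ y) = cong suc (dist≡∣△∣ x y)
dist≡∣△∣ (false ∷ x) (true ∷ y)  = cong suc (dist≡∣△∣ x y)
dist≡∣△∣ (false ∷ x) (false ∷ y) = dist≡∣△∣ x y

dist-refl : ∀ {n} (x : Subset n) → dist x x ≡ 0
dist-refl []          = refl
dist-refl (true ∷ x)  = dist-refl x
dist-refl (false ∷ x) = dist-refl x

dist-sym : ∀ {n} (x y : Subset n) → dist x y ≡ dist y x
dist-sym [] [] = refl
dist-sym (true ∷ x)  (true ∷ y)  = dist-sym x y
dist-sym (true ∷ x)  (false ∷ y) = cong suc (dist-sym x y)
dist-sym (false ∷ x) (true ∷ y)  = cong suc (dist-sym x y)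
dist-sym (false ∷ x) (false ∷ y) = dist-sym x y

dist≤n : ∀ {n} (x y : Subset n) → dist x y ≤ n
dist≤n [] [] = z≤n
dist≤n (true ∷ x)  (true ∷ y)  = m≤n⇒m≤1+n (dist≤n x y)
dist≤n (true ∷ x)  (false ∷ y) = s≤s (dist≤n x y)
dist≤n (false ∷ x) (true ∷ y)  = s≤s (dist≤n x y)
dist≤n (false ∷ x) (false ∷ y) = m≤n⇒m≤1+n (dist≤n x y)

size≤n : ∀ {n} (x : Subset n) → size x ≤ n
size≤n []          = z≤n
size≤n (true ∷ x)  = s≤s (size≤n x)
size≤n (false ∷ x) = m≤n⇒m≤1+n (size≤n x)

-- Swapping along a pair of sets

-- Toggling the coordinates in which u and v differ exchanges u and v.
swap : ∀ {n} → Subset n → Subset n → Subset n → Subset n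
swap [] [] []                = []
swap (a ∷ u) (b ∷ v) (c ∷ x) = ((a xor b) xor c) ∷ swap u v x

-- x contains u \ v and is disjoint from v \ u.
match : ∀ {n} → Subset n → Subset n → Subset n → Bool
match [] [] []                = true
match (a ∷ u) (b ∷ v) (c ∷ x) = (not (a xor b) ∨ not (a xor c)) ∧ match u v x

∧-elim : ∀ {a b} → a ∧ b ≡ true → a ≡ true × b ≡ true
∧-elim {true} {true} _ = refl , refl

match-refl : ∀ {n} (u v : Subset n) → match u v u ≡ true
match-refl [] [] = refl
match-refl (true ∷ u)  (true ∷ v)  = match-refl u v
match-refl (true ∷ u)  (false ∷ v) = match-refl u v
match-refl (false ∷ u) (true ∷ v)  = match-refl u v
match-refl (false ∷ u) (false ∷ v) = match-refl u v

swap-u : ∀ {n} (u v : Subset n) → swap u v u ≡ v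
swap-u [] [] = refl
swap-u (true ∷ u)  (true ∷ v)  = cong (true ∷_) (swap-u u v)
swap-u (true ∷ u)  (false ∷ v) = cong (false ∷_) (swap-u u v)
swap-u (false ∷ u) (true ∷ v)  = cong (true ∷_) (swap-u u v)
swap-u (false ∷ u) (false ∷ v) = cong (false ∷_) (swap-u u v)

xor-cancel : ∀ a c → a xor (a xor c) ≡ c
xor-cancel true true   = refl
xor-cancel true false  = refl
xor-cancel false _     = refl

swap-involutive : ∀ {n} (u v x : Subset n) → swap u v (swap u v x) ≡ x
swap-involutive [] [] [] = refl
swap-involutive (a ∷ u) (b ∷ v) (c ∷ x) = cong₂ _∷_ (xor-cancel (a xor b) c) (swap-involutive u v x)

∑-swap : ∀ {n} (u v : Subset n) (h : Subset n → ℕ) → ∑ (h ∘ swap u v) ≡ ∑ h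
∑-swap [] [] h = refl
∑-swap (true ∷ u)  (true ∷ v)  h = cong₂ _+_ (∑-swap u v _) (∑-swap u v _)
∑-swap (true ∷ u)  (false ∷ v) h = trans (cong₂ _+_ (∑-swap u v _) (∑-swap u v _)) (+-comm (∑ (h ∘ (false ∷_))) _)
∑-swap (false ∷ u) (true ∷ v)  h = trans (cong₂ _+_ (∑-swap u v _) (∑-swap u v _)) (+-comm (∑ (h ∘ (false ∷_))) _)
∑-swap (false ∷ u) (false ∷ v) h = cong₂ _+_ (∑-swap u v _) (∑-swap u v _)

dist-toggle : ∀ d a b → ⟦ (d xor a) xor (d xor b) ⟧ ≡ ⟦ a xor b ⟧
dist-toggle false a b         = refl
dist-toggle true true true    = refl
dist-toggle true true false   = refl
dist-toggle true false true   = refl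
dist-toggle true false false  = refl

dist-swap : ∀ {n} (u v x y : Subset n) → dist (swap u v x) (swap u v y) ≡ dist x y
dist-swap [] [] [] [] = refl
dist-swap (a ∷ u) (b ∷ v) (c ∷ x) (d ∷ y) = cong₂ _+_ (dist-toggle (a xor b) c d) (dist-swap u v x y)

weigh-swap : ∀ ω {n} (u v x : Subset n) → match u v x ≡ true →
  weigh ω (swap u v x) + weigh ω u ≡ weigh ω x + weigh ω v
weigh-swap ω [] [] [] _ = refl
weigh-swap ω {suc n} (a ∷ u) (b ∷ v) (c ∷ x) m = let mₕ , mₜ = ∧-elim m in begin
  (ite ((a xor b) xor c) + weigh ω (swap u v x)) + (ite a + weigh ω u)
    ≡⟨ interchange (ite ((a xor b) xor c)) _ _ _ ⟩
  (ite ((a xor b) xor c) + ite a) + (weigh ω (swap u v x) + weigh ω u)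
    ≡⟨ cong₂ _+_ (head a b c mₕ) (weigh-swap ω u v x mₜ) ⟩
  (ite c + ite b) + (weigh ω x + weigh ω v)
    ≡⟨ interchange (ite c) _ _ _ ⟩
  (ite c + weigh ω x) + (ite b + weigh ω v) ∎
  where
  open ≡-Reasoning
  ite : Bool → ℕ
  ite a = if a then ω n else 0
  head : ∀ a b c → not (a xor b) ∨ not (a xor c) ≡ true → ite ((a xor b) xor c) + ite a ≡ ite c + ite b
  head true  true  true  _ = refl
  head true  true  false _ = refl
  head true  false true  _ = +-comm 0 (ω n)
  head false true  false _ = +-comm (ω n) 0
  head false false true  _ = refl
  head false false false _ = refl

-- The compression order and the repair of distances

-- In the second case v arises from u by replacing one element by another of smaller position.
_≻_ : ∀ {n} → Subset n → Subset n → Set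
u ≻ v = size v < size u ⊎ (size v ≡ size u × dist u v ≤ 2 × pos v < pos u)

diff : ∀ {n} → Subset n → Subset n → ℕ
diff [] []           = 0
diff (a ∷ u) (b ∷ v) = ⟦ a ∧ not b ⟧ + diff u v

dist≡diff+diff : ∀ {n} (u v : Subset n) → dist u v ≡ diff u v + diff v u
dist≡diff+diff [] [] = refl
dist≡diff+diff (true ∷ u)  (true ∷ v)  = dist≡diff+diff u v
dist≡diff+diff (true ∷ u)  (false ∷ v) = cong suc (dist≡diff+diff u v)
dist≡diff+diff (false ∷ u) (true ∷ v)  = trans (cong suc (dist≡diff+diff u v)) (sym (+-suc (diff u v) _))
dist≡diff+diff (false ∷ u) (false ∷ v) = dist≡diff+diff u v

size+diff : ∀ {n} (u v : Subset n) → size u + diff v u ≡ size v + diff u v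
size+diff [] [] = refl
size+diff (true ∷ u)  (true ∷ v)  = cong suc (size+diff u v)
size+diff (true ∷ u)  (false ∷ v) = trans (cong suc (size+diff u v)) (sym (+-suc (size v) _))
size+diff (false ∷ u) (true ∷ v)  = trans (+-suc (size u) _) (cong suc (size+diff u v))
size+diff (false ∷ u) (false ∷ v) = size+diff u v

-- ∣(u \ v) ∩ y∣, ∣(v \ u) \ y∣, and the distance from x to y outside u △ v.
hit miss : ∀ {n} → Subset n → Subset n → Subset n → ℕ
hit [] [] []                 = 0
hit (a ∷ u) (b ∷ v) (d ∷ y)  = ⟦ (a ∧ not b) ∧ d ⟧ + hit u v y
miss [] [] []                = 0
miss (a ∷ u) (b ∷ v) (d ∷ y) = ⟦ (b ∧ not a) ∧ not d ⟧ + miss u v y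

off : ∀ {n} → Subset n → Subset n → Subset n → Subset n → ℕ
off [] [] [] []                       = 0
off (a ∷ u) (b ∷ v) (c ∷ x) (d ∷ y)   = ⟦ not (a xor b) ∧ (c xor d) ⟧ + off u v x y

hit≤ : ∀ {n} (u v y : Subset n) → hit u v y ≤ diff u v
hit≤ [] [] [] = z≤n
hit≤ (a ∷ u) (b ∷ v) (d ∷ y) = +-mono-≤ (⟦⟧-mono {(a ∧ not b) ∧ d} (proj₁ ∘ ∧-elim)) (hit≤ u v y)

miss≤ : ∀ {n} (u v y : Subset n) → miss u v y ≤ diff v u
miss≤ [] [] [] = z≤n
miss≤ (a ∷ u) (b ∷ v) (d ∷ y) = +-mono-≤ (⟦⟧-mono {(b ∧ not a) ∧ not d} (proj₁ ∘ ∧-elim)) (miss≤ u v y)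

hit-miss-match : ∀ {n} (u v y : Subset n) → hit u v y ≡ diff u v → miss u v y ≡ diff v u → match u v y ≡ true
hit-miss-match [] [] [] h m = refl
hit-miss-match (true ∷ u) (true ∷ v) (d ∷ y) h m = hit-miss-match u v y h m
hit-miss-match (true ∷ u) (false ∷ v) (true ∷ y) h m = hit-miss-match u v y (suc-injective h) m
hit-miss-match (true ∷ u) (false ∷ v) (false ∷ y) h m = contradiction (hit≤ u v y) (<⇒≱ (≤-reflexive (sym h)))
hit-miss-match (false ∷ u) (true ∷ v) (true ∷ y) h m = contradiction (miss≤ u v y) (<⇒≱ (≤-reflexive (sym m)))
hit-miss-match (false ∷ u) (true ∷ v) (false ∷ y) h m = hit-miss-match u v y h (suc-injective m)
hit-miss-match (false ∷ u) (false ∷ v) (d ∷ y) h m = hit-miss-match u v y h m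

-- Within `u △ v` the swapped set contains nothing of `u` and everything of `v`, so its
-- disagreements with `y` there are exactly the hits and the misses.
dist-swapˡ : ∀ {n} (u v x y : Subset n) → match u v x ≡ true →
  dist (swap u v x) y ≡ hit u v y + (miss u v y + off u v x y)
dist-swapˡ [] [] [] [] _ = refl
dist-swapˡ (true ∷ u) (true ∷ v) (c ∷ x) (d ∷ y) m = trans (cong (⟦ c xor d ⟧ +_) (dist-swapˡ u v x y m))
  (trans (x∙yz≈y∙xz ⟦ c xor d ⟧ (hit u v y) _) (cong (hit u v y +_) (x∙yz≈y∙xz ⟦ c xor d ⟧ (miss u v y) _)))
dist-swapˡ (false ∷ u) (false ∷ v) (c ∷ x) (d ∷ y) m = trans (cong (⟦ c xor d ⟧ +_) (dist-swapˡ u v x y m))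
  (trans (x∙yz≈y∙xz ⟦ c xor d ⟧ (hit u v y) _) (cong (hit u v y +_) (x∙yz≈y∙xz ⟦ c xor d ⟧ (miss u v y) _)))
dist-swapˡ (true ∷ u) (false ∷ v) (true ∷ x) (true ∷ y) m = cong suc (dist-swapˡ u v x y m)
dist-swapˡ (true ∷ u) (false ∷ v) (true ∷ x) (false ∷ y) m = dist-swapˡ u v x y m
dist-swapˡ (false ∷ u) (true ∷ v) (false ∷ x) (true ∷ y) m = dist-swapˡ u v x y m
dist-swapˡ (false ∷ u) (true ∷ v) (false ∷ x) (false ∷ y) m =
  trans (cong suc (dist-swapˡ u v x y m)) (sym (+-suc (hit u v y) _))

-- Within `u △ v` the matching set `x` is opposite to its swap, so it disagrees with `y` exactly at
-- the coordinates that are neither hits nor misses.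
dist+hit+miss : ∀ {n} (u v x y : Subset n) → match u v x ≡ true →
  dist x y + (hit u v y + miss u v y) ≡ dist u v + off u v x y
dist+hit+miss [] [] [] [] _ = refl
dist+hit+miss (true ∷ u) (true ∷ v) (c ∷ x) (d ∷ y) m = trans (+-assoc ⟦ c xor d ⟧ _ _)
  (trans (cong (⟦ c xor d ⟧ +_) (dist+hit+miss u v x y m)) (x∙yz≈y∙xz ⟦ c xor d ⟧ (dist u v) _))
dist+hit+miss (false ∷ u) (false ∷ v) (c ∷ x) (d ∷ y) m = trans (+-assoc ⟦ c xor d ⟧ _ _)
  (trans (cong (⟦ c xor d ⟧ +_) (dist+hit+miss u v x y m)) (x∙yz≈y∙xz ⟦ c xor d ⟧ (dist u v) _))
dist+hit+miss (true ∷ u) (false ∷ v) (true ∷ x) (true ∷ y) m =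
  trans (+-suc (dist x y) _) (cong suc (dist+hit+miss u v x y m))
dist+hit+miss (true ∷ u) (false ∷ v) (true ∷ x) (false ∷ y) m = cong suc (dist+hit+miss u v x y m)
dist+hit+miss (false ∷ u) (true ∷ v) (false ∷ x) (true ∷ y) m = cong suc (dist+hit+miss u v x y m)
dist+hit+miss (false ∷ u) (true ∷ v) (false ∷ x) (false ∷ y) m =
  trans (cong (dist x y +_) (+-suc (hit u v y) _)) (trans (+-suc (dist x y) _) (cong suc (dist+hit+miss u v x y m)))

record Exchange {n} (u v x y : Subset n) (e : ℕ) : Set where
  field
    y′      : Subset n
    dist-y  : dist y y′ ≡ hit u v y + e
    size-y′ : size y′ + hit u v y ≡ size y + e
    dist-x  : dist x y′ + miss u v y ≡ dist u v + (e + off u v x y)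

+-assoc-cong : ∀ k {a b c d} → a + b ≡ c + d → k + a + b ≡ k + c + d
+-assoc-cong k {a} {b} {c} {d} eq = trans (+-assoc k a b) (trans (cong (k +_) eq) (sym (+-assoc k c d)))

-- Delete from y everything in u \ v and add e elements of v \ u.
exchange : ∀ {n} (u v x y : Subset n) e → match u v x ≡ true → e ≤ miss u v y → Exchange u v x y e
exchange [] [] [] [] zero _ _ = record { y′ = [] ; dist-y = refl ; size-y′ = refl ; dist-x = refl }
exchange (true ∷ u) (true ∷ v) (c ∷ x) (d ∷ y) e m e≤ = record
  { y′ = d ∷ y′
  ; dist-y = trans (cong (λ δ → ⟦ δ ⟧ + dist y y′) (Bool.xor-same d)) dist-y
  ; size-y′ = +-assoc-cong (if d then 1 else 0) size-y′
  ; dist-x = trans (+-assoc ⟦ c xor d ⟧ _ _) (trans (cong (⟦ c xor d ⟧ +_) dist-x)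
      (trans (x∙yz≈y∙xz ⟦ c xor d ⟧ (dist u v) _) (cong (dist u v +_) (x∙yz≈y∙xz ⟦ c xor d ⟧ e _))))
  }
  where open Exchange (exchange u v x y e m e≤)
exchange (false ∷ u) (false ∷ v) (c ∷ x) (d ∷ y) e m e≤ = record
  { y′ = d ∷ y′
  ; dist-y = trans (cong (λ δ → ⟦ δ ⟧ + dist y y′) (Bool.xor-same d)) dist-y
  ; size-y′ = +-assoc-cong (if d then 1 else 0) size-y′
  ; dist-x = trans (+-assoc ⟦ c xor d ⟧ _ _) (trans (cong (⟦ c xor d ⟧ +_) dist-x)
      (trans (x∙yz≈y∙xz ⟦ c xor d ⟧ (dist u v) _) (cong (dist u v +_) (x∙yz≈y∙xz ⟦ c xor d ⟧ e _))))
  }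
  where open Exchange (exchange u v x y e m e≤)
exchange (true ∷ u) (false ∷ v) (true ∷ x) (true ∷ y) e m e≤ = record
  { y′ = false ∷ y′ ; dist-y = cong suc dist-y ; size-y′ = trans (+-suc (size y′) _) (cong suc size-y′)
  ; dist-x = cong suc dist-x }
  where open Exchange (exchange u v x y e m e≤)
exchange (true ∷ u) (false ∷ v) (true ∷ x) (false ∷ y) e m e≤ = record
  { y′ = false ∷ y′ ; dist-y = dist-y ; size-y′ = size-y′ ; dist-x = cong suc dist-x }
  where open Exchange (exchange u v x y e m e≤)
exchange (false ∷ u) (true ∷ v) (false ∷ x) (true ∷ y) e m e≤ = record
  { y′ = true ∷ y′ ; dist-y = dist-y ; size-y′ = cong suc size-y′ ; dist-x = cong suc dist-x }
  where open Exchange (exchange u v x y e m e≤)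
exchange (false ∷ u) (true ∷ v) (false ∷ x) (false ∷ y) zero m e≤ = record
  { y′ = false ∷ y′ ; dist-y = dist-y ; size-y′ = size-y′ ; dist-x = trans (+-suc (dist x y′) _) (cong suc dist-x) }
  where open Exchange (exchange u v x y zero m z≤n)
exchange (false ∷ u) (true ∷ v) (false ∷ x) (false ∷ y) (suc e) m e≤ = record
  { y′ = true ∷ y′ ; dist-y = trans (cong suc dist-y) (sym (+-suc (hit u v y) e))
  ; size-y′ = trans (cong suc size-y′) (sym (+-suc (size y) e))
  ; dist-x = cong suc (trans (+-suc (dist x y′) _)
      (trans (cong suc dist-x) (sym (+-suc (dist u v) _)))) }
  where open Exchange (exchange u v x y e m (s≤s⁻¹ e≤))

m+m≤2⇒m≤1 : ∀ m → m + m ≤ 2 → m ≤ 1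
m+m≤2⇒m≤1 zero          _  = z≤n
m+m≤2⇒m≤1 (suc zero)    _  = ≤-refl
m+m≤2⇒m≤1 (suc (suc m)) le = contradiction (≤-trans (m≤n+m (suc (suc m)) m) (s≤s⁻¹ (s≤s⁻¹ le))) λ ()

-- Splits the order into the two cases that `repair` can handle: strictly more to remove than to
-- add, or at most one element on either side.
≻⇒diff : ∀ {n} (u v : Subset n) → u ≻ v → diff v u < diff u v ⊎ (diff v u ≡ diff u v × diff u v ≤ 1)
≻⇒diff u v (inj₁ ∣v∣<∣u∣) = inj₁ (+-cancelˡ-< (size v) _ _
  (<-≤-trans (+-monoˡ-< (diff v u) ∣v∣<∣u∣) (≤-reflexive (size+diff u v))))
≻⇒diff u v (inj₂ (∣v∣≡∣u∣ , d≤2 , _)) = inj₂ (eq , m+m≤2⇒m≤1 (diff u v)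
  (subst (λ k → diff u v + k ≤ 2) eq (≤-trans (≤-reflexive (sym (dist≡diff+diff u v))) d≤2)))
  where
  eq : diff v u ≡ diff u v
  eq = +-cancelˡ-≡ (size v) _ _ (trans (cong (_+ diff v u) ∣v∣≡∣u∣) (size+diff u v))

-- In the next three lemmas h, m, o are hit, miss, off; X = dist x y and N = dist u v.
no-hit-bound : ∀ m o X N → X + (0 + m) ≡ N + o → m + m ≤ N → 0 + (m + o) ≤ X
no-hit-bound m o X N eq 2m≤N = +-cancelʳ-≤ m (m + o) X
  (linear _ _ 0 2m≤N (trans (ring m o N) (cong (_+ (m + m)) (sym eq))))
  where
  ring : ∀ m o N → m + o + m + N + 0 ≡ N + o + (m + m)
  ring = solve-∀

full-bound : ∀ h m o X N → X + m ≡ N + (m + o) → h + m ≤ N → h + (m + o) ≤ X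
full-bound h m o X N eq h+m≤N = +-cancelʳ-≤ m (h + (m + o)) X
  (linear _ _ 0 h+m≤N (trans (ring h m o N) (cong (_+ (h + m)) (sym eq))))
  where
  ring : ∀ h m o N → h + (m + o) + m + N + 0 ≡ N + (m + o) + (h + m)
  ring = solve-∀

partial-bound : ∀ h m o X N → X + m ≡ N + (h + o) → suc (m + m) ≤ N → suc h + (m + o) ≤ X
partial-bound h m o X N eq 2m<N = +-cancelʳ-≤ m (suc h + (m + o)) X
  (linear _ _ 0 2m<N (trans (ring h m o N) (cong (_+ suc (m + m)) (sym eq))))
  where
  ring : ∀ h m o N → suc h + (m + o) + m + N + 0 ≡ N + (h + o) + suc (m + m)
  ring = solve-∀

-- After the swap the distance to `y` is `h + m + o`. Without hits, `x` was already that far away,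
-- since `m + m ≤ dist u v`. Otherwise `y′` drops all hits and gains min(m, h - 1) elements: fewer
-- than `h`, which makes it smaller than `y`, and otherwise as many as possible, because each one
-- moves it further from `x`. As `y` does not match, fewer than `dist u v` coordinates change, which
-- brings `y′` into the range of `StableBelow`.
repair : ∀ {n} (u v x y : Subset n) → u ≻ v → match u v x ≡ true → match u v y ≡ false →
  dist (swap u v x) y ≤ dist x y ⊎
  (∃ λ y′ → size y′ < size y × dist y y′ < dist u v × dist (swap u v x) y ≤ dist x y′)
repair {n} u v x y u≻v mx my = go (hit u v y) refl
  where
  U V h m o : ℕ
  U = diff u v
  V = diff v u
  h = hit u v y
  m = miss u v y
  o = off u v x y
  V≤U : V ≤ U
  V≤U with ≻⇒diff u v u≻v
  ... | inj₁ V<U       = <⇒≤ V<U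
  ... | inj₂ (V≡U , _) = ≤-reflexive V≡U
  m≤U : m ≤ U
  m≤U = ≤-trans (miss≤ u v y) V≤U
  h+m≤N : h + m ≤ dist u v
  h+m≤N = ≤-trans (+-mono-≤ (hit≤ u v y) (miss≤ u v y)) (≤-reflexive (sym (dist≡diff+diff u v)))
  ¬both : ¬ (U ≤ h × V ≤ m)
  ¬both (U≤h , V≤m) with () ← trans (sym my)
    (hit-miss-match u v y (≤-antisym (hit≤ u v y) U≤h) (≤-antisym (miss≤ u v y) V≤m))
  h+m<N : h + m < dist u v
  h+m<N with U ≤? h
  ... | yes U≤h = <-≤-trans (+-mono-≤-< (hit≤ u v y) (≰⇒> (λ V≤m → ¬both (U≤h , V≤m))))
                    (≤-reflexive (sym (dist≡diff+diff u v)))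
  ... | no  U≰h = <-≤-trans (+-mono-<-≤ (≰⇒> U≰h) (miss≤ u v y)) (≤-reflexive (sym (dist≡diff+diff u v)))
  swapped : ∀ {k} → h + (m + o) ≤ k → dist (swap u v x) y ≤ k
  swapped = ≤-trans (≤-reflexive (dist-swapˡ u v x y mx))
  smaller : ∀ {e k} → e < h → k + h ≡ size y + e → k < size y
  smaller e<h eq = +-cancelʳ-< h _ _ (≤-<-trans (≤-reflexive eq) (+-monoʳ-< (size y) e<h))
  go : ∀ k → h ≡ k → dist (swap u v x) y ≤ dist x y ⊎
    (∃ λ y′ → size y′ < size y × dist y y′ < dist u v × dist (swap u v x) y ≤ dist x y′)
  go zero h≡0 = inj₁ (swapped (subst (λ k → k + (m + o) ≤ dist x y) (sym h≡0)
    (no-hit-bound m o (dist x y) (dist u v)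
      (subst (λ k → dist x y + (k + m) ≡ dist u v + o) h≡0 (dist+hit+miss u v x y mx))
      (≤-trans (+-mono-≤ m≤U (miss≤ u v y)) (≤-reflexive (sym (dist≡diff+diff u v)))))))
  go (suc k) h≡1+k with m ≤? k
  ... | yes m≤k = inj₂ (y′ , smaller (≤-trans (s≤s m≤k) (≤-reflexive (sym h≡1+k))) size-y′
      , ≤-<-trans (≤-reflexive dist-y) h+m<N
      , swapped (full-bound h m o (dist x y′) (dist u v) dist-x h+m≤N))
    where open Exchange (exchange u v x y m mx ≤-refl)
  ... | no m≰k = inj₂ (y′ , smaller (≤-reflexive (sym h≡1+k)) size-y′
      , ≤-<-trans (≤-trans (≤-reflexive dist-y) (+-monoʳ-≤ h k≤m)) h+m<N
      , swapped (subst (λ i → i + (m + o) ≤ dist x y′) (sym h≡1+k)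
          (partial-bound k m o (dist x y′) (dist u v) dist-x 2m<N)))
    where
    k<m : k < m
    k<m = ≰⇒> m≰k
    k≤m : k ≤ m
    k≤m = <⇒≤ k<m
    open Exchange (exchange u v x y k mx k≤m)
    V<U : V < U
    V<U with ≻⇒diff u v u≻v
    ... | inj₁ V<U         = V<U
    -- With at most one element on either side, one hit and one miss would already make `y` match.
    ... | inj₂ (V≡U , U≤1) = contradiction
      ( ≤-trans U≤1 (≤-trans (s≤s z≤n) (≤-reflexive (sym h≡1+k)))
      , ≤-trans (≤-trans (≤-reflexive V≡U) U≤1) (≤-trans (s≤s z≤n) k<m)) ¬both
    2m<N : suc (m + m) ≤ dist u v
    2m<N = ≤-trans (+-mono-≤ (≤-<-trans (miss≤ u v y) V<U) (miss≤ u v y)) (≤-reflexive (sym (dist≡diff+diff u v)))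

-- Compressions of cross-close families

StableBelow : ∀ {n} → ℕ → (Subset n → Bool) → Set
StableBelow k f = ∀ u v → dist u v < k → u ≻ v → f u ≡ true → f v ≡ true

Cross : ∀ {n} → ℕ → (Subset n → Bool) → (Subset n → Bool) → Set
Cross D f g = ∀ x y → f x ≡ true → g y ≡ true → dist x y < D

-- The (u,v)-compression of extremal set theory as a membership test: a matching member moves to its
-- swap unless the swap is already a member.
compress : ∀ {n} → Subset n → Subset n → (Subset n → Bool) → Subset n → Bool
compress u v f x =
  if match u v x then f x ∧ f (swap u v x) else (f x ∨ (match u v (swap u v x) ∧ f (swap u v x)))

∨-elim : ∀ {a b} → a ∨ b ≡ true → a ≡ true ⊎ b ≡ true
∨-elim {true}  _  = inj₁ refl
∨-elim {false} eq = inj₂ eq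

compress-origin : ∀ {n} (u v : Subset n) f x → compress u v f x ≡ true →
  (f x ≡ true × (match u v x ≡ true → f (swap u v x) ≡ true)) ⊎
  (match u v (swap u v x) ≡ true × f (swap u v x) ≡ true)
compress-origin u v f x eq with match u v x
... | true  = let fx , fsx = ∧-elim eq in inj₁ (fx , λ _ → fsx)
... | false with ∨-elim {f x} eq
...   | inj₁ fx  = inj₁ (fx , λ ())
...   | inj₂ msx = inj₂ (∧-elim msx)

-- If `y` matches, it stayed only because its swap is also in `g`, and swapping both sets preserves
-- the distance. If not, `repair` compares with `y` itself or with a smaller member of `g`.
moved-vs-kept : ∀ {n D} (u v : Subset n) {f g} → u ≻ v → StableBelow (dist u v) g → Cross D f g →
  ∀ x y → match u v (swap u v x) ≡ true → f (swap u v x) ≡ true →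
  g y ≡ true → (match u v y ≡ true → g (swap u v y) ≡ true) → dist x y < D
moved-vs-kept u v {f} {g} u≻v stable cross x y msx fsx gy gsy with match u v y in my
... | true  = ≤-<-trans (≤-reflexive (sym (dist-swap u v x y))) (cross _ _ fsx (gsy refl))
... | false with repair u v (swap u v x) y u≻v msx my
...   | inj₁ le = ≤-<-trans (≤-trans unswap le) (cross _ _ fsx gy)
  where
  unswap : dist x y ≤ dist (swap u v (swap u v x)) y
  unswap = ≤-reflexive (cong (λ z → dist z y) (sym (swap-involutive u v x)))
...   | inj₂ (y′ , ∣y′∣<∣y∣ , near , le) = ≤-<-trans (≤-trans unswap le)
        (cross _ _ fsx (stable y y′ near (inj₁ ∣y′∣<∣y∣) gy))
  where
  unswap : dist x y ≤ dist (swap u v (swap u v x)) y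
  unswap = ≤-reflexive (cong (λ z → dist z y) (sym (swap-involutive u v x)))

cross-sym : ∀ {n D} {f g : Subset n → Bool} → Cross D f g → Cross D g f
cross-sym cross y x gy fx = ≤-<-trans (≤-reflexive (dist-sym y x)) (cross x y fx gy)

compress-cross : ∀ {n D} (u v : Subset n) {f g} → u ≻ v →
  StableBelow (dist u v) f → StableBelow (dist u v) g → Cross D f g →
  Cross D (compress u v f) (compress u v g)
compress-cross u v {f} {g} u≻v sf sg cross x y cx cy with compress-origin u v f x cx | compress-origin u v g y cy
... | inj₁ (fx , _)    | inj₁ (gy , _)    = cross x y fx gy
... | inj₂ (_ , fsx)   | inj₂ (_ , gsy)   = ≤-<-trans (≤-reflexive (sym (dist-swap u v x y))) (cross _ _ fsx gsy)
... | inj₂ (msx , fsx) | inj₁ (gy , gsy)  = moved-vs-kept u v u≻v sg cross x y msx fsx gy gsy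
... | inj₁ (fx , fsx)  | inj₂ (msy , gsy) = ≤-<-trans (≤-reflexive (dist-sym x y))
  (moved-vs-kept u v u≻v sf (cross-sym cross) y x msy gsy fx fsx)

-- Weights and normalisation

weigh-swap-< : ∀ ω {n} (u v x : Subset n) → match u v x ≡ true → weigh ω v < weigh ω u → weigh ω (swap u v x) < weigh ω x
weigh-swap-< ω u v x mx lt = +-cancelʳ-< (weigh ω u) _ _
  (≤-<-trans (≤-reflexive (weigh-swap ω u v x mx)) (+-monoʳ-< (weigh ω x) lt))

weigh-offset : ∀ N {n} (x : Subset n) → weigh (N +_) x ≡ N * size x + pos x
weigh-offset N [] = sym (trans (+-identityʳ (N * 0)) (*-zeroʳ N))
weigh-offset N {suc n} (true ∷ x) = trans (cong (N + n +_) (weigh-offset N x)) (ring N n (size x) (pos x))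
  where
  ring : ∀ N n s p → N + n + (N * s + p) ≡ N * suc s + (n + p)
  ring = solve-∀
weigh-offset N (false ∷ x) = weigh-offset N x

pos≤n*n : ∀ {n} (x : Subset n) → pos x ≤ n * n
pos≤n*n [] = z≤n
pos≤n*n {suc n} (a ∷ x) = m≤n⇒m≤1+n (+-mono-≤ (head a) (≤-trans (pos≤n*n x) (*-monoʳ-≤ n (n≤1+n n))))
  where
  head : ∀ a → (if a then n else 0) ≤ n
  head true  = ≤-refl
  head false = z≤n

-- The large offset makes the cardinality dominate the positions.
weight : ∀ {n} → Subset n → ℕ
weight {n} = weigh (suc (n * n) +_)

≻⇒weight : ∀ {n} (u v : Subset n) → u ≻ v → weight v < weight u
≻⇒weight {n} u v u≻v = subst₂ _<_ (sym (weigh-offset N v)) (sym (weigh-offset N u)) (go u≻v)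
  where
  open ≤-Reasoning
  N : ℕ
  N = suc (n * n)
  go : u ≻ v → N * size v + pos v < N * size u + pos u
  go (inj₁ ∣v∣<∣u∣) = begin-strict
    N * size v + pos v <⟨ +-monoʳ-< (N * size v) (s≤s (pos≤n*n v)) ⟩
    N * size v + N     ≡⟨ trans (+-comm (N * size v) N) (sym (*-suc N (size v))) ⟩
    N * suc (size v)   ≤⟨ *-monoʳ-≤ N ∣v∣<∣u∣ ⟩
    N * size u         ≤⟨ m≤m+n (N * size u) (pos u) ⟩
    N * size u + pos u ∎
  go (inj₂ (∣v∣≡∣u∣ , _ , pos<)) = +-mono-≤-< (≤-reflexive (cong (N *_) ∣v∣≡∣u∣)) pos<

-- Every pair of `x` and its swap is counted twice. Comparing doubled sums avoids choosing a
-- representative of each pair.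
∑-pairs : ∀ {n} (u v : Subset n) (h : Subset n → ℕ) → ∑ (λ x → h x + h (swap u v x)) ≡ ∑ h + ∑ h
∑-pairs u v h = trans (∑-+ h (h ∘ swap u v)) (cong (∑ h +_) (∑-swap u v h))

double-cancel-≤ : ∀ a b → a + a ≤ b + b → a ≤ b
double-cancel-≤ a b le with a ≤? b
... | yes a≤b = a≤b
... | no  a≰b = contradiction le (<⇒≱ (+-mono-< (≰⇒> a≰b) (≰⇒> a≰b)))

double-cancel-< : ∀ a b → a + a < b + b → a < b
double-cancel-< a b lt with a <? b
... | yes a<b = a<b
... | no  a≮b = contradiction (≤-trans lt (+-mono-≤ (≮⇒≥ a≮b) (≮⇒≥ a≮b))) (<-irrefl refl)

-- Compression acts on each pair of `x` and its swap separately: it leaves the pair alone or carries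
-- its only member from the heavier set to the lighter one. Cardinality is thus preserved, and
-- weight does not grow.
data Effect {n} (u v : Subset n) (f : Subset n → Bool) (x : Subset n) : Set where
  same  : compress u v f x ≡ f x → compress u v f (swap u v x) ≡ f (swap u v x) → Effect u v f x
  leave : f x ≡ true → f (swap u v x) ≡ false → compress u v f x ≡ false → compress u v f (swap u v x) ≡ true →
          weight (swap u v x) < weight x → Effect u v f x
  enter : f x ≡ false → f (swap u v x) ≡ true → compress u v f x ≡ true → compress u v f (swap u v x) ≡ false →
          weight x < weight (swap u v x) → Effect u v f x

effect : ∀ {n} (u v : Subset n) f → u ≻ v → ∀ x → Effect u v f x
effect u v f u≻v x with match u v x in mx | match u v (swap u v x) in msx
-- If both ends matched, each swap would lower the weight, yet two swaps are the identity.
... | true | true = contradiction (lighter x mx)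
      (<-asym (subst (λ z → weight z < weight (swap u v x)) (swap-involutive u v x) (lighter (swap u v x) msx)))
  where
  lighter : ∀ x → match u v x ≡ true → weight (swap u v x) < weight x
  lighter x mx = weigh-swap-< _ u v x mx (≻⇒weight u v u≻v)
... | false | false = same c₁ c₂
  where
  c₁ : compress u v f x ≡ f x
  c₁ rewrite mx | msx = Bool.∨-identityʳ (f x)
  c₂ : compress u v f (swap u v x) ≡ f (swap u v x)
  c₂ rewrite msx | swap-involutive u v x | mx = Bool.∨-identityʳ _
... | true | false = go (f x) (f (swap u v x)) refl refl
  where
  c₁ : compress u v f x ≡ f x ∧ f (swap u v x)
  c₁ rewrite mx = refl
  c₂ : compress u v f (swap u v x) ≡ f (swap u v x) ∨ f x
  c₂ rewrite msx | swap-involutive u v x | mx = refl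
  go : ∀ p q → f x ≡ p → f (swap u v x) ≡ q → Effect u v f x
  go true false fx fsx = leave fx fsx (trans c₁ (cong₂ _∧_ fx fsx)) (trans c₂ (cong₂ _∨_ fsx fx))
    (weigh-swap-< _ u v x mx (≻⇒weight u v u≻v))
  go true  true  fx fsx = same (trans c₁ (trans (cong₂ _∧_ fx fsx) (sym fx))) (trans c₂ (trans (cong₂ _∨_ fsx fx) (sym fsx)))
  go false true  fx fsx = same (trans c₁ (trans (cong₂ _∧_ fx fsx) (sym fx))) (trans c₂ (trans (cong₂ _∨_ fsx fx) (sym fsx)))
  go false false fx fsx = same (trans c₁ (trans (cong₂ _∧_ fx fsx) (sym fx))) (trans c₂ (trans (cong₂ _∨_ fsx fx) (sym fsx)))
... | false | true = go (f x) (f (swap u v x)) refl refl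
  where
  c₁ : compress u v f x ≡ f x ∨ f (swap u v x)
  c₁ rewrite mx | msx = refl
  c₂ : compress u v f (swap u v x) ≡ f (swap u v x) ∧ f x
  c₂ rewrite msx | swap-involutive u v x = refl
  go : ∀ p q → f x ≡ p → f (swap u v x) ≡ q → Effect u v f x
  go false true fx fsx = enter fx fsx (trans c₁ (cong₂ _∨_ fx fsx)) (trans c₂ (cong₂ _∧_ fsx fx))
    (subst (λ z → weight z < weight (swap u v x)) (swap-involutive u v x)
      (weigh-swap-< _ u v (swap u v x) msx (≻⇒weight u v u≻v)))
  go true  true  fx fsx = same (trans c₁ (trans (cong₂ _∨_ fx fsx) (sym fx))) (trans c₂ (trans (cong₂ _∧_ fsx fx) (sym fsx)))
  go true  false fx fsx = same (trans c₁ (trans (cong₂ _∨_ fx fsx) (sym fx))) (trans c₂ (trans (cong₂ _∧_ fsx fx) (sym fsx)))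
  go false false fx fsx = same (trans c₁ (trans (cong₂ _∨_ fx fsx) (sym fx))) (trans c₂ (trans (cong₂ _∧_ fsx fx) (sym fsx)))

#-compress : ∀ {n} (u v : Subset n) f → u ≻ v → # (compress u v f) ≡ # f
#-compress u v f u≻v = ≤-antisym
  (double-cancel-≤ _ _ (≤-reflexive pairs)) (double-cancel-≤ _ _ (≤-reflexive (sym pairs)))
  where
  c = compress u v f
  pair : ∀ x → ⟦ c x ⟧ + ⟦ c (swap u v x) ⟧ ≡ ⟦ f x ⟧ + ⟦ f (swap u v x) ⟧
  pair x with effect u v f u≻v x
  ... | same e₁ e₂ rewrite e₁ | e₂ = refl
  ... | leave e₁ e₂ e₃ e₄ _ rewrite e₁ | e₂ | e₃ | e₄ = refl
  ... | enter e₁ e₂ e₃ e₄ _ rewrite e₁ | e₂ | e₃ | e₄ = refl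
  pairs : # c + # c ≡ # f + # f
  pairs = trans (sym (∑-pairs u v (⟦_⟧ ∘ c))) (trans (∑-cong pair) (∑-pairs u v (⟦_⟧ ∘ f)))

weighted : ∀ {n} → (Subset n → Bool) → Subset n → ℕ
weighted f x = if f x then weight x else 0

module _ {n} (u v : Subset n) (f : Subset n → Bool) (u≻v : u ≻ v) where
  private
    c = compress u v f

  weighted-pair : ∀ x → weighted c x + weighted c (swap u v x) ≤ weighted f x + weighted f (swap u v x)
  weighted-pair x with effect u v f u≻v x
  ... | same e₁ e₂ rewrite e₁ | e₂ = ≤-refl
  ... | leave e₁ e₂ e₃ e₄ lt rewrite e₁ | e₂ | e₃ | e₄ = ≤-trans (<⇒≤ lt) (m≤m+n _ 0)
  ... | enter e₁ e₂ e₃ e₄ lt rewrite e₁ | e₂ | e₃ | e₄ = ≤-trans (≤-reflexive (+-identityʳ _)) (<⇒≤ lt)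

  weighted-compress-≤ : ∑ (weighted c) ≤ ∑ (weighted f)
  weighted-compress-≤ = double-cancel-≤ _ _
    (subst₂ _≤_ (∑-pairs u v (weighted c)) (∑-pairs u v (weighted f)) (∑-mono weighted-pair))

  weighted-compress-< : f u ≡ true → f v ≡ false → ∑ (weighted c) < ∑ (weighted f)
  weighted-compress-< fu fv = double-cancel-< _ _ (subst₂ _<_ (∑-pairs u v (weighted c)) (∑-pairs u v (weighted f))
    (∑-mono-< weighted-pair u strict))
    where
    c-u : c u ≡ false
    c-u rewrite match-refl u v | swap-u u v | fu | fv = refl
    strict : weighted c u + weighted c (swap u v u) < weighted f u + weighted f (swap u v u)
    strict with effect u v f u≻v u
    ... | same e₁ _ with () ← trans (sym c-u) (trans e₁ fu)
    ... | enter e₁ _ _ _ _ with () ← trans (sym fu) e₁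
    ... | leave e₁ e₂ e₃ e₄ lt rewrite e₁ | e₂ | e₃ | e₄ = ≤-trans lt (m≤m+n _ 0)

record Normalised {n} (D : ℕ) (f g : Subset n → Bool) : Set where
  field
    f′ g′    : Subset n → Bool
    #f′      : # f′ ≡ # f
    #g′      : # g′ ≡ # g
    cross′   : Cross D f′ g′
    stable-f : ∀ u v → u ≻ v → f′ u ≡ true → f′ v ≡ true
    stable-g : ∀ u v → u ≻ v → g′ u ≡ true → g′ v ≡ true

_≻?_ : ∀ {n} (u v : Subset n) → Dec (u ≻ v)
u ≻? v = (size v <? size u) ⊎-dec ((size v ≟ size u) ×-dec (dist u v ≤? 2) ×-dec (pos v <? pos u))

Violates : ∀ {n} → (Subset n → Bool) → Subset n → Subset n → Set
Violates f u v = f u ≡ true × f v ≡ false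

-- Compressing along a violating pair at minimal distance keeps the families cross-close and lowers the total weight.
normalise : ∀ {n D} (f g : Subset n → Bool) → Cross D f g → Normalised D f g
normalise {n} {D} f g cross = go f g cross (<-wellFounded _)
  where
  total : (Subset n → Bool) → (Subset n → Bool) → ℕ
  total f g = ∑ (weighted f) + ∑ (weighted g)
  go : ∀ f g → Cross D f g → Acc _<_ (total f g) → Normalised D f g
  go f g cross (acc rec) = stabilise (suc n) 0 (+-identityʳ (suc n)) (λ _ _ ()) (λ _ _ ())
    where
    stabilise : ∀ i k → i + k ≡ suc n → StableBelow k f → StableBelow k g → Normalised D f g
    -- Here `k` is `suc n`, which exceeds every distance.
    stabilise zero k refl sf sg = record
      { f′ = f ; g′ = g ; #f′ = refl ; #g′ = refl ; cross′ = cross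
      ; stable-f = λ u v → sf u v (s≤s (dist≤n u v)) ; stable-g = λ u v → sg u v (s≤s (dist≤n u v)) }
    stabilise (suc i) k i+k sf sg
      with anySubset? (λ u → anySubset? (λ v → (dist u v ≟ k) ×-dec (u ≻? v) ×-dec
             (((f u Bool.≟ true) ×-dec (f v Bool.≟ false)) ⊎-dec ((g u Bool.≟ true) ×-dec (g v Bool.≟ false)))))
    ... | no none = stabilise i (suc k) (trans (+-suc i k) i+k)
            (extend sf (λ u v d u≻v bad → none (u , v , d , u≻v , inj₁ bad)))
            (extend sg (λ u v d u≻v bad → none (u , v , d , u≻v , inj₂ bad)))
      where
      extend : ∀ {f} → StableBelow k f → (∀ u v → dist u v ≡ k → u ≻ v → ¬ Violates f u v) → StableBelow (suc k) f
      extend {f} s ok u v d u≻v fu with m≤n⇒m<n∨m≡n (s≤s⁻¹ d)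
      ... | inj₁ d<k = s u v d<k u≻v fu
      ... | inj₂ d≡k with f v in fv
      ...   | true  = refl
      ...   | false = contradiction (fu , fv) (ok u v d≡k u≻v)
    ... | yes (u , v , refl , u≻v , bad) = record
      { f′ = f′ ; g′ = g′ ; #f′ = trans #f′ (#-compress u v f u≻v) ; #g′ = trans #g′ (#-compress u v g u≻v)
      ; cross′ = cross′ ; stable-f = stable-f ; stable-g = stable-g }
      where
      lighter : Violates f u v ⊎ Violates g u v → total (compress u v f) (compress u v g) < total f g
      lighter (inj₁ (fu , fv)) = +-mono-<-≤ (weighted-compress-< u v f u≻v fu fv) (weighted-compress-≤ u v g u≻v)
      lighter (inj₂ (gu , gv)) = +-mono-≤-< (weighted-compress-≤ u v f u≻v) (weighted-compress-< u v g u≻v gu gv)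
      open Normalised (go (compress u v f) (compress u v g) (compress-cross u v u≻v sf sg cross) (rec (lighter bad)))

-- Cascades and the Kruskal-Katona theorem for shifted families

-- Pascal's rule holds definitionally, unlike for _C_.
binom : ℕ → ℕ → ℕ
binom n       zero    = 1
binom zero    (suc k) = 0
binom (suc n) (suc k) = binom n k + binom n (suc k)

binom-mono : ∀ {m n} k → m ≤ n → binom m k ≤ binom n k
binom-mono zero    _         = ≤-refl
binom-mono (suc k) z≤n       = z≤n
binom-mono (suc k) (s≤s m≤n) = +-mono-≤ (binom-mono k m≤n) (binom-mono (suc k) m≤n)

binom-positive : ∀ {n k} → k ≤ n → 1 ≤ binom n k
binom-positive z≤n       = ≤-refl
binom-positive (s≤s k≤n) = ≤-trans (binom-positive k≤n) (m≤m+n _ _)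

k>n⇒binom≡0 : ∀ {n k} → n < k → binom n k ≡ 0
k>n⇒binom≡0 {zero}  (s≤s _)   = refl
k>n⇒binom≡0 {suc n} (s≤s n<k) = cong₂ _+_ (k>n⇒binom≡0 n<k) (k>n⇒binom≡0 (m≤n⇒m≤1+n n<k))

binom-nn : ∀ n → binom n n ≡ 1
binom-nn zero    = refl
binom-nn (suc n) = cong₂ _+_ (binom-nn n) (k>n⇒binom≡0 (n<1+n n))

-- The number of k-sets in a family of all subsets of an m-set together with
-- all a ∪ {∞}, where a ranges over the subsets of an x-set and ∞ is a new element.
cascade : ℕ → ℕ → ℕ → ℕ
cascade m x zero    = 1
cascade m x (suc k) = binom m (suc k) + binom x k

cascade-pascal : ∀ m x k → cascade (suc m) (suc x) (suc k) ≡ cascade m x k + cascade m x (suc k)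
cascade-pascal m x zero    = refl
cascade-pascal m x (suc k) = interchange (binom m (suc k)) _ _ _

cascade-positive : ∀ m x k → k ≤ suc x → 1 ≤ cascade m x k
cascade-positive m x zero    _         = ≤-refl
cascade-positive m x (suc k) (s≤s k≤x) = ≤-trans (binom-positive k≤x) (m≤n+m _ _)

cascade-mono : ∀ {m m′ x x′} k → m ≤ m′ → x ≤ x′ → cascade m x k ≤ cascade m′ x′ k
cascade-mono zero    _    _    = ≤-refl
cascade-mono (suc k) m≤m′ x≤x′ = +-mono-≤ (binom-mono (suc k) m≤m′) (binom-mono k x≤x′)

-- A parameter that is really raised becomes `k`; then the first binomial is 0 and the second is 1,
-- so at most 1 is gained.
cascade-⊔ : ∀ m x k → cascade (m ⊔ k) (x ⊔ k) (suc k) ≤ suc (cascade m x (suc k))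
cascade-⊔ m x k = ≤-trans (+-mono-≤ left right) (≤-reflexive (+-suc _ _))
  where
  left : binom (m ⊔ k) (suc k) ≤ binom m (suc k)
  left with ≤-total k m
  ... | inj₁ k≤m = ≤-reflexive (cong (λ i → binom i (suc k)) (m≥n⇒m⊔n≡m k≤m))
  ... | inj₂ m≤k = ≤-trans (≤-reflexive (trans (cong (λ i → binom i (suc k)) (m≤n⇒m⊔n≡n m≤k)) (k>n⇒binom≡0 (n<1+n k)))) z≤n
  right : binom (x ⊔ k) k ≤ suc (binom x k)
  right with ≤-total k x
  ... | inj₁ k≤x = m≤n⇒m≤1+n (≤-reflexive (cong (λ i → binom i k) (m≥n⇒m⊔n≡m k≤x)))
  ... | inj₂ x≤k = ≤-trans (≤-reflexive (trans (cong (λ i → binom i k) (m≤n⇒m⊔n≡n x≤k)) (binom-nn k))) (s≤s z≤n)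

-- Used at distance 1: dropping one element loses at most the largest position, which a new head
-- outweighs.
pos-lipschitz : ∀ {n} (x y : Subset n) → pos x ≤ pos y + dist x y * pred n
pos-lipschitz [] [] = z≤n
pos-lipschitz {suc n} (a ∷ x) (b ∷ y) = begin
  ite a + pos x                                          ≤⟨ +-mono-≤ (head a b) (pos-lipschitz x y) ⟩
  (ite b + ⟦ a xor b ⟧ * n) + (pos y + dist x y * pred n)
    ≤⟨ +-monoʳ-≤ (ite b + ⟦ a xor b ⟧ * n) (+-monoʳ-≤ (pos y) (*-monoʳ-≤ (dist x y) (pred[n]≤n {n}))) ⟩
  (ite b + ⟦ a xor b ⟧ * n) + (pos y + dist x y * n)      ≡⟨ interchange (ite b) _ _ _ ⟩
  (ite b + pos y) + (⟦ a xor b ⟧ * n + dist x y * n)      ≡⟨ cong (ite b + pos y +_) (*-distribʳ-+ n ⟦ a xor b ⟧ _) ⟨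
  (ite b + pos y) + (⟦ a xor b ⟧ + dist x y) * n          ∎
  where
  open ≤-Reasoning
  ite : Bool → ℕ
  ite a = if a then n else 0
  head : ∀ a b → ite a ≤ ite b + ⟦ a xor b ⟧ * n
  head true  true  = m≤m+n n _
  head true  false = ≤-reflexive (sym (+-identityʳ n))
  head false _     = z≤n

dist-⊥ : ∀ {n} (z : Subset n) → dist ⊥ z ≡ size z
dist-⊥ []          = refl
dist-⊥ (true ∷ z)  = cong suc (dist-⊥ z)
dist-⊥ (false ∷ z) = dist-⊥ z

size-⊥ : ∀ n → size (⊥ {n}) ≡ 0
size-⊥ zero    = refl
size-⊥ (suc n) = size-⊥ n

Uniform : ∀ {n} → ℕ → (Subset n → Bool) → Set
Uniform q K = ∀ z → K z ≡ true → size z ≡ q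

Shifted : ∀ {n} → (Subset n → Bool) → Set
Shifted K = ∀ z z′ → K z ≡ true → size z′ ≡ size z → dist z z′ ≤ 2 → pos z < pos z′ → K z′ ≡ true

-- dist w z + ∣w∣ ≡ ∣z∣ expresses w ⊆ z.
Shadow : ∀ {n} → ℕ → ℕ → (Subset n → Bool) → (Subset n → Bool) → Set
Shadow q t K L = ∀ z w → K z ≡ true → dist w z + t ≡ q → size w ≡ t → L w ≡ true

-- Induction on the ground set. If the link `K₁` of the head is large, its shadows on two
-- neighbouring levels supply the members of `L` with and without the head, and Pascal's rule adds
-- them up. If it is small, the sets avoiding the head are many; shifting puts their shadow into
-- `K₁`, which is then large after all. The bound `q ≤ suc x` keeps the second binomial positive, so
-- `K` is never empty.
kruskal-katona : ∀ {n} q t m x (K L : Subset n → Bool) → Uniform q K → Shifted K → Shadow q t K L →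
  q ≤ suc m → q ≤ suc x → t ≤ q → cascade m x q ≤ # K → cascade m x t ≤ # L
kruskal-katona {n} q zero m x K L uniform _ shadow _ q≤x _ le =
  let z , Kz = #-nonempty K (≤-trans (cascade-positive m x q q≤x) le)
  in #-positive L ⊥ (shadow z ⊥ Kz (trans (+-identityʳ _) (trans (dist-⊥ z) (uniform z Kz))) (size-⊥ n))
kruskal-katona {n} (suc q) (suc t) m x K L uniform shifted shadow q≤m q≤x t≤q le with m≤n⇒m<n∨m≡n (s≤s⁻¹ t≤q)
... | inj₂ refl = ≤-trans le (#-mono (λ z Kz → shadow z z Kz (cong (_+ suc q) (dist-refl z)) (uniform z Kz)))
kruskal-katona {zero} (suc q) (suc t) m x K L uniform _ _ _ q≤x _ le | inj₁ _
  with [] , K[] ← #-nonempty K (≤-trans (cascade-positive m x (suc q) q≤x) le)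
  with () ← uniform [] K[]
kruskal-katona {suc n} (suc (suc q)) (suc t) (suc m) (suc x) K L uniform shifted shadow (s≤s q≤m) (s≤s q≤x) (s≤s t≤q) le
  | inj₁ t<q with cascade m x (suc q) ≤? # (K ∘ (true ∷_))
... | yes big = ≤-trans (≤-reflexive (cascade-pascal m x t)) (+-mono-≤
    (kruskal-katona (suc q) t m x K₁ (L ∘ (true ∷_)) uniform₁ shifted₁
      (λ z w Kz d s → shadow (true ∷ z) (true ∷ w) Kz (trans (+-suc (dist w z) t) (cong suc d)) (cong suc s))
      q≤m q≤x t≤q big)
    (kruskal-katona (suc q) (suc t) m x K₁ (L ∘ (false ∷_)) uniform₁ shifted₁
      (λ z w Kz d s → shadow (true ∷ z) (false ∷ w) Kz (cong suc d) s)
      q≤m q≤x t<q big))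
  where
  K₁ = K ∘ (true ∷_)
  uniform₁ : Uniform (suc q) K₁
  uniform₁ z Kz = suc-injective (uniform (true ∷ z) Kz)
  shifted₁ : Shifted K₁
  shifted₁ z z′ Kz s d p = shifted (true ∷ z) (true ∷ z′) Kz (cong suc s) d (+-monoʳ-< n p)
-- The level stays while `m` and `x` have dropped by one, so the size hypotheses may fail by one.
-- Raising both to `suc q` restores them; the cost of 1 is covered by the strict inequality in
-- `K₀-big`.
... | no small = contradiction
    (≤-trans (cascade-mono (suc q) (m≤m⊔n m (suc q)) (m≤m⊔n x (suc q)))
      (kruskal-katona (suc (suc q)) (suc q) (m ⊔ suc q) (x ⊔ suc q) K₀ K₁
        (λ z → uniform (false ∷ z)) (λ z z′ → shifted (false ∷ z) (false ∷ z′)) shadow₀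
        (s≤s (m≤n⊔m m (suc q))) (s≤s (m≤n⊔m x (suc q))) (n≤1+n _) (≤-trans (cascade-⊔ m x (suc q)) K₀-big)))
    small
  where
  K₀ = K ∘ (false ∷_)
  K₁ = K ∘ (true ∷_)
  K₀-big : cascade m x (suc (suc q)) < # K₀
  K₀-big = ≰⇒> (λ K₀≤ → <-irrefl refl (<-≤-trans (+-mono-<-≤ (≰⇒> small) K₀≤)
    (≤-trans (≤-reflexive (sym (cascade-pascal m x (suc q)))) le)))
  -- Moving an element of z to the head, which has the largest position, yields every head ∷ w with w below z.
  shadow₀ : Shadow (suc (suc q)) (suc q) K₀ K₁
  shadow₀ z w Kz d s = shifted (false ∷ z) (true ∷ w) Kz (trans (cong suc s) (sym (uniform (false ∷ z) Kz)))
    (≤-reflexive (cong suc dist≡1)) (later (≤-trans (≤-reflexive (sym dist≡1)) (dist≤n z w)) dist≡1 (pos-lipschitz z w))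
    where
    dist≡1 : dist z w ≡ 1
    dist≡1 = trans (dist-sym z w) (+-cancelʳ-≡ (suc q) (dist w z) 1 d)
    later : ∀ {n a b d} → 1 ≤ n → d ≡ 1 → a ≤ b + d * pred n → a < n + b
    later {suc n} {a} {b} _ refl le = s≤s (≤-trans le (≤-reflexive (trans (cong (b +_) (+-identityʳ n)) (+-comm b n))))

-- Complements, balls and the bound for cross-close families

dist+dist-∁ : ∀ {n} (w z : Subset n) → dist w (∁ z) + dist w z ≡ n
dist+dist-∁ [] [] = refl
dist+dist-∁ (true ∷ w)  (true ∷ z)  = cong suc (dist+dist-∁ w z)
dist+dist-∁ (true ∷ w)  (false ∷ z) = trans (+-suc _ _) (cong suc (dist+dist-∁ w z))
dist+dist-∁ (false ∷ w) (true ∷ z)  = trans (+-suc _ _) (cong suc (dist+dist-∁ w z))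
dist+dist-∁ (false ∷ w) (false ∷ z) = cong suc (dist+dist-∁ w z)

dist-∁-∁ : ∀ {n} (x y : Subset n) → dist (∁ x) (∁ y) ≡ dist x y
dist-∁-∁ [] [] = refl
dist-∁-∁ (true ∷ x)  (true ∷ y)  = dist-∁-∁ x y
dist-∁-∁ (true ∷ x)  (false ∷ y) = cong suc (dist-∁-∁ x y)
dist-∁-∁ (false ∷ x) (true ∷ y)  = cong suc (dist-∁-∁ x y)
dist-∁-∁ (false ∷ x) (false ∷ y) = dist-∁-∁ x y

∁-involutive : ∀ {n} (x : Subset n) → ∁ (∁ x) ≡ x
∁-involutive []      = refl
∁-involutive (a ∷ x) = cong₂ _∷_ (Bool.not-involutive a) (∁-involutive x)

∑-∁ : ∀ {n} (h : Subset n → ℕ) → ∑ (h ∘ ∁) ≡ ∑ h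
∑-∁ {zero}  h = refl
∑-∁ {suc n} h = trans (cong₂ _+_ (∑-∁ (h ∘ (false ∷_))) (∑-∁ (h ∘ (true ∷_)))) (+-comm (∑ (h ∘ (false ∷_))) _)

weigh-∁ : ∀ ω {n} (x y : Subset n) → weigh ω x + weigh ω (∁ x) ≡ weigh ω y + weigh ω (∁ y)
weigh-∁ ω [] [] = refl
weigh-∁ ω {suc n} (a ∷ x) (b ∷ y) = trans (interchange (ite a) _ _ _)
  (trans (cong₂ _+_ (trans (head a) (sym (head b))) (weigh-∁ ω x y)) (interchange (ite b) _ _ _))
  where
  ite : Bool → ℕ
  ite a = if a then ω n else 0
  head : ∀ a → ite a + ite (not a) ≡ ω n
  head true  = +-identityʳ (ω n)
  head false = refl

size-∁ : ∀ {n} (x : Subset n) → size x + size (∁ x) ≡ n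
size-∁ []          = refl
size-∁ (true ∷ x)  = cong suc (size-∁ x)
size-∁ (false ∷ x) = trans (+-suc (size x) _) (cong suc (size-∁ x))

subset-of-size : ∀ {n} (z : Subset n) k → k ≤ size z → ∃ λ w → dist w z + k ≡ size z × size w ≡ k
subset-of-size [] zero _ = [] , refl , refl
subset-of-size (true ∷ z) zero _ =
  let w , d , s = subset-of-size z zero z≤n in false ∷ w , cong suc d , s
subset-of-size (true ∷ z) (suc k) (s≤s k≤) =
  let w , d , s = subset-of-size z k k≤ in true ∷ w , trans (+-suc (dist w z) k) (cong suc d) , cong suc s
subset-of-size (false ∷ z) k k≤ =
  let w , d , s = subset-of-size z k k≤ in false ∷ w , d , s

does-true : ∀ {P : Set} (d : Dec P) → does d ≡ true → P
does-true (yes p) _ = p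

smallerThan : ∀ {n} → ℕ → Subset n → Bool
smallerThan k z = does (size z <? k)

-- The radius is `k - 1`; the empty ball at `k = 0` lets `ball-suc` start from nothing.
ball : ℕ → ℕ → ℕ
ball n k = # {n} (smallerThan k)

missing : ∀ {n} → (Subset n → Bool) → ℕ → Subset n → Bool
missing f τ w = does (size w ≟ τ) ∧ not (f w)

module _ {n} (f : Subset n → Bool) (stable : ∀ u v → u ≻ v → f u ≡ true → f v ≡ true) where

  missing-bounds-size : ∀ {v} → f v ≡ false → ∀ u → f u ≡ true → size u ≤ size v
  missing-bounds-size {v} fv u fu = ≮⇒≥ (λ lt → contradiction (trans (sym fv) (stable u v (inj₁ lt) fu)) λ ())

  -- A missing set of size below `τ` would confine all of `f` to sizes below `τ`.
  contains-ball : ∀ τ → ball n τ < # f → ∀ w → size w < τ → f w ≡ true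
  contains-ball τ many w w<τ with f w in fw
  ... | true  = refl
  ... | false = contradiction
    (#-mono (λ u fu → dec-true (size u <? τ) (≤-<-trans (missing-bounds-size fw u fu) w<τ)))
    (<⇒≱ many)

  -- One missing set of size `τ` confines `f` to sizes up to `τ`; then `f` and the missing sets lie
  -- disjointly in one ball. If none is missing, `1 ≤ c` suffices.
  few-missing : ∀ τ M c → ball n (suc τ) ≤ M + c → 1 ≤ c → M < # f → # (missing f τ) < c
  few-missing τ M c ball≤ 1≤c many = ≰⇒> λ c≤ → <⇒≱ (+-mono-<-≤ many c≤)
    (≤-trans (disjoint (#-nonempty (missing f τ) (≤-trans 1≤c c≤))) ball≤)
    where
    disjoint : ∃ (λ w → missing f τ w ≡ true) → # f + # (missing f τ) ≤ ball n (suc τ)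
    disjoint (w , mw) = ≤-trans (≤-reflexive (sym (∑-+ (⟦_⟧ ∘ f) (⟦_⟧ ∘ missing f τ)))) (∑-mono pointwise)
      where
      ∣w∣≡τ : size w ≡ τ
      ∣w∣≡τ = does-true (size w ≟ τ) (proj₁ (∧-elim mw))
      fw : f w ≡ false
      fw = Bool.not-injective (proj₂ (∧-elim {does (size w ≟ τ)} mw))
      pointwise : ∀ u → ⟦ f u ⟧ + ⟦ missing f τ u ⟧ ≤ ⟦ smallerThan (suc τ) u ⟧
      pointwise u with f u in fu
      ... | true rewrite Bool.∧-zeroʳ (does (size u ≟ τ)) | dec-true (size u <? suc τ)
              (s≤s (≤-trans (missing-bounds-size fw u fu) (≤-reflexive ∣w∣≡τ))) = ≤-refl
      ... | false = ⟦⟧-mono λ m → dec-true (size u <? suc τ)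
              (s≤s (≤-reflexive (does-true (size u ≟ τ) (proj₁ (∧-elim m)))))

-- Here `Q + e` is n and `τ + e` is p. Disjoint sets are as far apart as their sizes add up to, so
-- once `f` has every set of size up to `τ`, no member of `g` exceeds size `e`. A member of size
-- exactly `e` excludes from `f` all sets of size `τ + 1` in its complement, which has size `Q`.
cross-bound : ∀ Q e τ m x M (f g : Subset (Q + e) → Bool) → suc τ ≤ Q → Q ≤ suc m → Q ≤ suc x →
  Cross (suc τ + e) f g → ball (Q + e) (suc τ) ≤ M → ball (Q + e) (suc (suc τ)) ≤ M + cascade m x (suc τ) →
  M < # f → # g < ball (Q + e) e + cascade m x Q
cross-bound Q e τ m x M f₀ g₀ τ<Q Q≤m Q≤x cross₀ small≤M large≤M M<#f₀ =
  ≤-<-trans (≤-trans (≤-reflexive (sym #g′)) g-split) (+-monoʳ-< (ball n e) few-K)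
  where
  n : ℕ
  n = Q + e
  open Normalised (normalise f₀ g₀ cross₀) renaming (f′ to f; g′ to g)
  M<#f : M < # f
  M<#f = <-≤-trans M<#f₀ (≤-reflexive (sym #f′))
  low : ∀ w → size w < suc τ → f w ≡ true
  low = contains-ball f stable-f (suc τ) (≤-<-trans small≤M M<#f)
  L K : Subset n → Bool
  L = missing f (suc τ)
  K z = does (size z ≟ Q) ∧ g (∁ z)
  few-L : # L < cascade m x (suc τ)
  few-L = few-missing f stable-f (suc τ) M _ large≤M (cascade-positive m x (suc τ) (≤-trans τ<Q Q≤x)) M<#f
  uniform : Uniform Q K
  uniform z Kz = does-true (size z ≟ Q) (proj₁ (∧-elim Kz))
  ∧-intro : ∀ {a b} → a ≡ true → b ≡ true → a ∧ b ≡ true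
  ∧-intro refl refl = refl
  -- Complementation reverses positions: `g` is stable towards small ones, `K` towards large ones.
  shifted : Shifted K
  shifted z z′ Kz s d p = ∧-intro (dec-true (size z′ ≟ Q) (trans s (uniform z Kz)))
    (stable-g (∁ z) (∁ z′) (inj₂ (size-eq , ≤-trans (≤-reflexive (dist-∁-∁ z z′)) d , pos-lt)) (proj₂ (∧-elim Kz)))
    where
    size-eq : size (∁ z′) ≡ size (∁ z)
    size-eq = +-cancelˡ-≡ (size z′) _ _ (trans (weigh-∁ _ z′ z) (cong (_+ size (∁ z)) (sym s)))
    pos-lt : pos (∁ z′) < pos (∁ z)
    pos-lt = +-cancelˡ-< (pos z) _ _ (<-≤-trans (+-monoˡ-< (pos (∁ z′)) p) (≤-reflexive (weigh-∁ _ z′ z)))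
  shadow : Shadow Q (suc τ) K L
  shadow z w Kz d s = ∧-intro (dec-true (size w ≟ suc τ) s) (not-f (f w) refl)
    where
    far : dist w (∁ z) ≡ suc τ + e
    far = +-cancelʳ-≡ (dist w z) _ _ (trans (dist+dist-∁ w z) (trans (cong (_+ e) (sym d)) (ring (dist w z) (suc τ) e)))
      where
      ring : ∀ a b c → a + b + c ≡ b + c + a
      ring = solve-∀
    not-f : ∀ b → f w ≡ b → not b ≡ true
    not-f false _  = refl
    not-f true  fw = contradiction (cross′ w (∁ z) fw (proj₂ (∧-elim Kz))) (<-irrefl far)
  few-K : # K < cascade m x Q
  few-K = ≰⇒> (λ le → <⇒≱ few-L
    (kruskal-katona Q (suc τ) m x K L uniform shifted shadow Q≤m Q≤x τ<Q le))
  not-large : ∀ y → g y ≡ true → size y ≤ e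
  not-large y gy = ≮⇒≥ λ e<y → far e<y (≤-total τ (size (∁ y)))
    where
    d+d : ∀ w → dist w y + dist w (∁ y) ≡ n
    d+d w = trans (+-comm (dist w y) _) (dist+dist-∁ w y)
    -- The witness in `f` is a `τ`-subset of the complement of `y`, or the whole complement if that
    -- is no larger than `τ`.
    far : e < size y → ¬ (τ ≤ size (∁ y) ⊎ size (∁ y) ≤ τ)
    far e<y (inj₁ τ≤) = <⇒≱ (cross′ w y (low w (s≤s (≤-reflexive s))) gy) bound
      where
      w = proj₁ (subset-of-size (∁ y) τ τ≤)
      d = proj₁ (proj₂ (subset-of-size (∁ y) τ τ≤))
      s = proj₂ (proj₂ (subset-of-size (∁ y) τ τ≤))
      bound : suc (τ + e) ≤ dist w y
      bound = ≤-trans (s≤s (≤-reflexive (+-comm τ e))) (≤-trans (+-monoˡ-≤ τ e<y) (≤-reflexive (sym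
        (+-cancelʳ-≡ (dist w (∁ y)) _ _ (trans (d+d w)
          (trans (sym (size-∁ y)) (trans (cong (size y +_) (sym d)) (ring (size y) _ τ))))))))
        where
        ring : ∀ a b c → a + (b + c) ≡ a + c + b
        ring = solve-∀
    far e<y (inj₂ ≤τ) = <⇒≱ (cross′ (∁ y) y (low (∁ y) (s≤s ≤τ)) gy)
      (≤-trans (+-monoˡ-≤ e τ<Q) (≤-reflexive (sym (trans (sym (+-identityʳ _))
        (trans (cong (dist (∁ y) y +_) (sym (dist-refl (∁ y)))) (d+d (∁ y)))))))
  g-split : # g ≤ ball n e + # K
  g-split = ≤-trans (∑-mono pointwise)
    (≤-reflexive (trans (∑-+ (⟦_⟧ ∘ smallerThan e) (⟦_⟧ ∘ K ∘ ∁)) (cong (ball n e +_) (∑-∁ (⟦_⟧ ∘ K)))))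
    where
    pointwise : ∀ y → ⟦ g y ⟧ ≤ ⟦ smallerThan e y ⟧ + ⟦ K (∁ y) ⟧
    pointwise y with g y in gy
    ... | false = z≤n
    ... | true with m≤n⇒m<n∨m≡n (not-large y gy)
    ...   | inj₁ lt rewrite dec-true (size y <? e) lt = s≤s z≤n
    ...   | inj₂ eq = ≤-trans (≤-reflexive (sym (cong ⟦_⟧ Ky))) (m≤n+m _ _)
      where
      Ky : K (∁ y) ≡ true
      Ky = ∧-intro (dec-true (size (∁ y) ≟ Q) (+-cancelˡ-≡ e _ _
        (trans (cong (_+ size (∁ y)) (sym eq)) (trans (size-∁ y) (+-comm Q e)))))
        (trans (cong g (∁-involutive y)) gy)

-- From a b-coloring to two cross-close families

∑ᶠ : ∀ {k} → (Fin k → ℕ) → ℕ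
∑ᶠ {zero}  h = 0
∑ᶠ {suc k} h = h zero + ∑ᶠ (h ∘ suc)

∑ᶠ-lower : ∀ {k} m (h : Fin k → ℕ) → (∀ i → m ≤ h i) → k * m ≤ ∑ᶠ h
∑ᶠ-lower {zero}  m h m≤ = z≤n
∑ᶠ-lower {suc k} m h m≤ = +-mono-≤ (m≤ zero) (∑ᶠ-lower m (h ∘ suc) (m≤ ∘ suc))

∑ᶠ-∑ : ∀ {k n} (h : Fin k → Subset n → ℕ) → ∑ᶠ (λ i → ∑ (h i)) ≡ ∑ (λ x → ∑ᶠ (λ i → h i x))
∑ᶠ-∑ {zero}  {n} h = sym (∑-0 n)
∑ᶠ-∑ {suc k} {n} h = trans (cong (∑ (h zero) +_) (∑ᶠ-∑ (h ∘ suc))) (sym (∑-+ (h zero) _))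

∑ᶠ-zero : ∀ k → ∑ᶠ {k} (λ _ → 0) ≡ 0
∑ᶠ-zero zero    = refl
∑ᶠ-zero (suc k) = ∑ᶠ-zero k

∑ᶠ-single : ∀ {k} (j : Fin k) w → ∑ᶠ (λ i → if does (j Fin.≟ i) then w else 0) ≡ w
∑ᶠ-single {suc k} zero    w = trans (cong (w +_) (∑ᶠ-zero k)) (+-identityʳ w)
∑ᶠ-single {suc k} (suc j) w = ∑ᶠ-single j w

module _ {n k} (c : Subset n → Fin k) (w : Subset n → ℕ) where

  inClass : Fin k → Subset n → ℕ
  inClass i x = if does (c x Fin.≟ i) then w x else 0

  inClass-≡ : ∀ {i x} → c x ≡ i → inClass i x ≡ w x
  inClass-≡ {i} {x} cx rewrite dec-true (c x Fin.≟ i) cx = refl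

  class-sums : ∀ m → (∀ i → m ≤ ∑ (inClass i)) → k * m ≤ ∑ w
  class-sums m m≤ = ≤-trans (∑ᶠ-lower m _ m≤)
    (≤-reflexive (trans (∑ᶠ-∑ inClass) (∑-cong (λ x → ∑ᶠ-single (c x) (w x)))))

record Dichotomy (n p k : ℕ) : Set where
  field
    f g      : Subset n → Bool
    cross    : Cross (suc p) f g
    k≤#g     : k ≤ # g
    k*2≤2ⁿ+f : k * 2 ≤ 2 ^ n + # f

module _ {n p k} (c : Subset n → Fin k) (b-coloring : IsBColoring (QPow n p) k c) where
  private
    _≟ˢ_ : (x y : Subset n) → Dec (x ≡ y)
    _≟ˢ_ = Vec.≡-dec Bool._≟_

  companion? : ∀ x → Dec (∃ λ y → c y ≡ c x × y ≢ x)
  companion? x = anySubset? (λ y → (c y Fin.≟ c x) ×-dec ¬? (y ≟ˢ x))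

  alone : Subset n → Bool
  alone x = not (does (companion? x))

  alone-unique : ∀ x → alone x ≡ true → ∀ y → c y ≡ c x → y ≡ x
  alone-unique x ax y cy with companion? x | y ≟ˢ x
  ... | _     | yes y≡x = y≡x
  ... | no ¬c | no  y≢x = contradiction (y , cy , y≢x) ¬c

  far? : ∀ z → Dec (∃ λ x → alone x ≡ true × ¬ (dist x z < suc p))
  far? z = anySubset? (λ x → (alone x Bool.≟ true) ×-dec ¬? (dist x z <? suc p))

  nearAlone : Subset n → Bool
  nearAlone z = not (does (far? z))

  alone-cross : Cross (suc p) alone nearAlone
  alone-cross x z ax nz with far? z | dist x z <? suc p
  ... | _     | yes lt = lt
  ... | no ¬f | no ≮   = contradiction (x , ax , ≮) ¬f

  dominating : Fin k → Subset n
  dominating i = proj₁ (proj₂ b-coloring i)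

  c-dominating : ∀ i → c (dominating i) ≡ i
  c-dominating i = proj₁ (proj₂ (proj₂ b-coloring i))

  -- The only vertex of a singleton class must itself be the neighbour that a dominating vertex has
  -- in that class, unless the two coincide.
  dominating-near : ∀ i → nearAlone (dominating i) ≡ true
  dominating-near i = cong not (dec-false (far? v) λ (x , ax , far) → far (s≤s (near x ax)))
    where
    v = dominating i
    near : ∀ x → alone x ≡ true → dist x v ≤ p
    near x ax with c x Fin.≟ i
    ... | yes cx≡i rewrite alone-unique x ax v (trans (c-dominating i) (sym cx≡i)) = ≤-trans (≤-reflexive (dist-refl x)) z≤n
    ... | no  cx≢i with proj₂ (proj₂ (proj₂ b-coloring i)) (c x) cx≢i
    ...   | u , (_ , ∣v△u∣≤p) , cu rewrite alone-unique x ax u cu =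
            ≤-trans (≤-reflexive (trans (dist-sym x v) (dist≡∣△∣ v x))) ∣v△u∣≤p

  dichotomy : Dichotomy n p k
  dichotomy = record
    { f = alone ; g = nearAlone ; cross = alone-cross
    ; k≤#g = ≤-trans (≤-reflexive (sym (*-identityʳ k))) (class-sums c (⟦_⟧ ∘ nearAlone) 1 λ i →
        ≤-trans (≤-reflexive (sym (trans (inClass-≡ c (⟦_⟧ ∘ nearAlone) (c-dominating i)) (cong ⟦_⟧ (dominating-near i)))))
          (point≤∑ _ (dominating i)))
    ; k*2≤2ⁿ+f = ≤-trans (class-sums c w 2 two)
        (≤-reflexive (trans (∑-+ (λ _ → 1) (⟦_⟧ ∘ alone)) (cong (_+ # alone) (∑-1 n))))
    }
    where
    -- With singleton classes counted double, every class weighs at least 2.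
    w : Subset n → ℕ
    w x = 1 + ⟦ alone x ⟧
    two : ∀ i → 2 ≤ ∑ (inClass c w i)
    two i = go (companion? (dominating i)) refl
      where
      v = dominating i
      go : (d : Dec (∃ λ y → c y ≡ c v × y ≢ v)) → companion? v ≡ d → 2 ≤ ∑ (inClass c w i)
      go (no _) eq = ≤-trans (≤-reflexive (sym (trans (inClass-≡ c w (c-dominating i))
        (cong (λ d → 1 + ⟦ not (does d) ⟧) eq)))) (point≤∑ _ v)
      go (yes (y , cy , y≢v)) _ = ≤-trans
        (+-mono-≤ (one y (trans cy (c-dominating i))) (one v (c-dominating i))) (points≤∑ _ y v y≢v)
        where
        one : ∀ x → c x ≡ i → 1 ≤ inClass c w i x
        one x cx = ≤-trans (s≤s z≤n) (≤-reflexive (sym (inClass-≡ c w cx)))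

-- Sizes of balls and binomial estimates

C≡binom : ∀ n k → n C k ≡ binom n k
C≡binom n       zero    = refl
C≡binom zero    (suc k) = k>n⇒nCk≡0 {0} {suc k} (s≤s z≤n)
C≡binom (suc n) (suc k) = trans (sym (nCk+nC[k+1]≡[n+1]C[k+1] n k)) (cong₂ _+_ (C≡binom n k) (C≡binom n (suc k)))

binom-sym : ∀ a b → binom (a + b) a ≡ binom (a + b) b
binom-sym a b = trans (sym (C≡binom (a + b) a)) (trans (nCk≡nC[n∸k] (m≤m+n a b))
  (trans (cong ((a + b) C_) (m+n∸m≡n a b)) (C≡binom (a + b) b)))

ball-0 : ∀ n → ball n 0 ≡ 0
ball-0 n = ∑-0 n

ball-suc : ∀ n k → ball n (suc k) ≡ ball n k + binom n k
ball-suc zero    zero    = refl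
ball-suc zero    (suc k) = refl
ball-suc (suc n) zero    = begin
  ball n 0 + ball n 1     ≡⟨ cong₂ _+_ (ball-0 n) (ball-suc n 0) ⟩
  ball n 0 + 1            ≡⟨ cong (_+ 1) (trans (ball-0 n) (sym (ball-0 (suc n)))) ⟩
  ball (suc n) 0 + 1      ∎ where open ≡-Reasoning
ball-suc (suc n) (suc k) = trans (cong₂ _+_ (ball-suc n k) (ball-suc n (suc k))) (interchange (ball n k) _ _ _)

Σ0to≡ball : ∀ n m → Σ0to m (λ i → n C i) ≡ ball n (suc m)
Σ0to≡ball n zero = sym (trans (ball-suc n 0) (cong (_+ 1) (ball-0 n)))
Σ0to≡ball n (suc m) = begin
  sum (map (n C_) (upTo (suc (suc m))))            ≡⟨ cong (sum ∘ map (n C_)) (upTo-∷ʳ (suc m)) ⟨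
  sum (map (n C_) (upTo (suc m) ∷ʳ suc m))         ≡⟨ cong sum (map-++ (n C_) (upTo (suc m)) _) ⟩
  sum (map (n C_) (upTo (suc m)) ∷ʳ (n C suc m))   ≡⟨ sum-++ (map (n C_) (upTo (suc m))) _ ⟩
  Σ0to m (n C_) + (n C suc m + 0)                  ≡⟨ cong₂ _+_ (Σ0to≡ball n m) (trans (+-identityʳ _) (C≡binom n (suc m))) ⟩
  ball n (suc m) + binom n (suc m)                 ≡⟨ ball-suc n (suc m) ⟨
  ball n (suc (suc m))                             ∎ where open ≡-Reasoning

2^suc : ∀ m → 2 ^ suc m ≡ 2 ^ m + 2 ^ m
2^suc m = cong (2 ^ m +_) (+-identityʳ (2 ^ m))

double-injective : ∀ a b → a + a ≡ b + b → a ≡ b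
double-injective a b eq = ≤-antisym (double-cancel-≤ a b (≤-reflexive eq)) (double-cancel-≤ b a (≤-reflexive (sym eq)))

-- In odd dimension exactly one of a set and its complement has size at most `q`.
ball-half : ∀ q → ball (q + suc q) (suc q) ≡ 2 ^ (q + q)
ball-half q = double-injective _ _ (begin
  ball n (suc q) + ball n (suc q)
    ≡⟨ cong (ball n (suc q) +_) (∑-∁ (⟦_⟧ ∘ smallerThan {n} (suc q))) ⟨
  ball n (suc q) + ∑ (⟦_⟧ ∘ smallerThan {n} (suc q) ∘ ∁)
    ≡⟨ ∑-+ (⟦_⟧ ∘ smallerThan {n} (suc q)) _ ⟨
  ∑ {n} (λ z → ⟦ smallerThan (suc q) z ⟧ + ⟦ smallerThan (suc q) (∁ z) ⟧)
    ≡⟨ ∑-cong exactly-one ⟩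
  ∑ {n} (λ _ → 1)         ≡⟨ ∑-1 n ⟩
  2 ^ n                   ≡⟨ cong (2 ^_) (+-suc q q) ⟩
  2 ^ suc (q + q)         ≡⟨ 2^suc (q + q) ⟩
  2 ^ (q + q) + 2 ^ (q + q) ∎)
  where
  open ≡-Reasoning
  n : ℕ
  n = q + suc q
  exactly-one : ∀ (z : Subset n) → ⟦ smallerThan (suc q) z ⟧ + ⟦ smallerThan (suc q) (∁ z) ⟧ ≡ 1
  exactly-one z = go (size z <? suc q) (size (∁ z) <? suc q)
    where
    go : (a : Dec (size z < suc q)) (b : Dec (size (∁ z) < suc q)) → ⟦ does a ⟧ + ⟦ does b ⟧ ≡ 1
    go (yes _) (no _)  = refl
    go (no _)  (yes _) = refl
    go (yes a) (yes b) = contradiction (≤-reflexive (trans (sym (+-suc q q)) (sym (size-∁ z))))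
      (<⇒≱ (s≤s (+-mono-≤ (s≤s⁻¹ a) (s≤s⁻¹ b))))
    go (no a) (no b) = contradiction (+-mono-≤ (≮⇒≥ a) (≮⇒≥ b)) (<⇒≱ (s≤s (≤-reflexive (size-∁ z))))

-- The head coordinate splits the ball into two balls of the odd cube whose radii differ by one; the
-- symmetric binomial completes the smaller to half of that cube.
ball-middle : ∀ q → ball (suc q + suc q) (suc q) + binom (q + suc q) (suc q) ≡ 2 ^ (q + suc q)
ball-middle q = begin
  ball n q + ball n (suc q) + binom n (suc q) ≡⟨ ring (ball n q) (ball n (suc q)) _ ⟩
  ball n q + binom n (suc q) + ball n (suc q) ≡⟨ cong (λ b → ball n q + b + ball n (suc q)) (binom-sym q (suc q)) ⟨
  ball n q + binom n q + ball n (suc q)       ≡⟨ cong (_+ ball n (suc q)) (ball-suc n q) ⟨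
  ball n (suc q) + ball n (suc q)             ≡⟨ cong₂ _+_ (ball-half q) (ball-half q) ⟩
  2 ^ (q + q) + 2 ^ (q + q)                   ≡⟨ 2^suc (q + q) ⟨
  2 ^ suc (q + q)                             ≡⟨ cong (2 ^_) (+-suc q q) ⟨
  2 ^ n                                       ∎
  where
  open ≡-Reasoning
  n : ℕ
  n = q + suc q
  ring : ∀ a b c → a + b + c ≡ a + c + b
  ring = solve-∀

binom-absorb : ∀ n k → suc k * binom n (suc k) + k * binom n k ≡ n * binom n k
binom-absorb zero    zero    = refl
binom-absorb zero    (suc k) = cong₂ _+_ (*-zeroʳ k) (*-zeroʳ k)
binom-absorb (suc n) zero    = cong suc (binom-absorb n zero)
binom-absorb (suc n) (suc k) = begin
  suc (suc k) * (b₁ + b₂) + suc k * (b₀ + b₁)                           ≡⟨ ring k b₀ b₁ b₂ ⟩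
  (suc (suc k) * b₂ + suc k * b₁) + (suc k * b₁ + k * b₀) + (b₀ + b₁)
    ≡⟨ cong₂ (λ x y → x + y + (b₀ + b₁)) (binom-absorb n (suc k)) (binom-absorb n k) ⟩
  n * b₁ + n * b₀ + (b₀ + b₁)                                           ≡⟨ ring′ n b₀ b₁ ⟩
  suc n * (b₀ + b₁)                                                     ∎
  where
  open ≡-Reasoning
  b₀ b₁ b₂ : ℕ
  b₀ = binom n k
  b₁ = binom n (suc k)
  b₂ = binom n (suc (suc k))
  ring : ∀ k a b c → suc (suc k) * (b + c) + suc k * (a + b) ≡ (suc (suc k) * c + suc k * b) + (suc k * b + k * a) + (a + b)
  ring = solve-∀
  ring′ : ∀ n a b → n * b + n * a + (a + b) ≡ suc n * (a + b)
  ring′ = solve-∀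

-- The first two terms of Vandermonde's identity.
binom-vandermonde : ∀ m w k → binom m (suc k) + w * binom m k ≤ binom (w + m) (suc k)
binom-vandermonde m zero    k = ≤-reflexive (+-identityʳ _)
binom-vandermonde m (suc w) k = ≤-trans (≤-reflexive (x∙yz≈y∙xz (binom m (suc k)) (binom m k) _))
  (+-mono-≤ (binom-mono k (m≤n+m m w)) (binom-vandermonde m w k))

binom-1 : ∀ n → binom n 1 ≡ n
binom-1 zero    = refl
binom-1 (suc n) = cong suc (binom-1 n)

binom-2 : ∀ n → 2 * binom n 2 + n ≡ n * n
binom-2 n = trans (cong (λ b → 2 * binom n 2 + b) (sym (trans (*-identityˡ (binom n 1)) (binom-1 n))))
  (trans (binom-absorb n 1) (cong (n *_) (binom-1 n)))

-- The pairs 3 ≤ t < q are those with t = 3 + i and q = 4 + i + j; the proof needs (q + 2 - t) t ≥ 2 (q + 1),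
-- which fails only for i = j = 0.
triple-binom : ∀ i j → 1 ≤ i + j → let q = 4 + i + j ; t = 3 + i in 3 * binom (q + t) t ≤ binom (suc (q + suc q)) t
triple-binom i j 1≤i+j = begin
  3 * s                                ≡⟨ ring₀ s ⟩
  s + 2 * s                            ≤⟨ +-monoʳ-≤ s 2s≤wb ⟩
  s + w * b                            ≤⟨ binom-vandermonde (q + t) w k ⟩
  binom (w + (q + t)) t                ≡⟨ cong (λ n → binom n t) (ring₁ i j) ⟩
  binom (suc (q + suc q)) t            ∎
  where
  open ≤-Reasoning
  q t k w s b : ℕ
  q = 4 + i + j
  t = 3 + i
  k = 2 + i
  w = 3 + j
  s = binom (q + t) t
  b = binom (q + t) k
  ring₀ : ∀ s → 3 * s ≡ s + 2 * s
  ring₀ = solve-∀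
  ring₁ : ∀ i j → (3 + j) + ((4 + i + j) + (3 + i)) ≡ suc ((4 + i + j) + suc (4 + i + j))
  ring₁ = solve-∀
  absorb : t * s ≡ suc q * b
  absorb = +-cancelʳ-≡ (k * b) _ _ (trans (binom-absorb (q + t) k) (ring i j b))
    where
    ring : ∀ i j b → ((4 + i + j) + (3 + i)) * b ≡ suc (4 + i + j) * b + (2 + i) * b
    ring = solve-∀
  2q+2≤wt : 2 * suc q ≤ w * t
  2q+2≤wt = linear _ _ (i * j) 1≤i+j (ring i j)
    where
    ring : ∀ i j → 2 * suc (4 + i + j) + (i + j) + i * j ≡ (3 + j) * (3 + i) + 1
    ring = solve-∀
  2s≤wb : 2 * s ≤ w * b
  2s≤wb = *-cancelˡ-≤ (suc q) (begin
    suc q * (2 * s)   ≡⟨ ring₂ (suc q) s ⟩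
    2 * suc q * s     ≤⟨ *-monoˡ-≤ s 2q+2≤wt ⟩
    w * t * s         ≡⟨ *-assoc w t s ⟩
    w * (t * s)       ≡⟨ cong (w *_) absorb ⟩
    w * (suc q * b)   ≡⟨ ring₃ w (suc q) b ⟩
    suc q * (w * b)   ∎)
    where
    ring₂ : ∀ a s → a * (2 * s) ≡ 2 * a * s
    ring₂ = solve-∀
    ring₃ : ∀ a b c → a * (b * c) ≡ b * (a * c)
    ring₃ = solve-∀

-- The summand 2 stems from the strict bound on `g`, and q = 3, t = 2 needs it: 30 ≤ 29 + 2. For t ≥
-- 3 the two outermost layers suffice; by Pascal's rule they add up to C(2q+2, t).
3binom≤ball+2 : ∀ q t → 2 ≤ t → t < q → 3 * binom (q + t) t ≤ ball (q + suc q) (suc t) + 2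
3binom≤ball+2 q t 2≤t t<q with m≤n⇒m<n∨m≡n 2≤t
... | inj₂ refl = *-cancelˡ-≤ 2 (+-cancelʳ-≤ (3 * (q + 2)) _ _ (begin
    2 * (3 * binom (q + 2) 2) + 3 * (q + 2)  ≡⟨ ring₀ (binom (q + 2) 2) (q + 2) ⟩
    3 * (2 * binom (q + 2) 2 + (q + 2))      ≡⟨ cong (3 *_) (binom-2 (q + 2)) ⟩
    -- The right side exceeds the left by q² - 3q + 2, and `t<q` says 3 ≤ q.
    3 * ((q + 2) * (q + 2))                  ≤⟨ linear _ _ 2 (*-monoˡ-≤ q t<q) (ring₁ q) ⟩
    n * n + n + 6 + 3 * (q + 2)              ≡⟨ cong (λ a → a + n + 6 + 3 * (q + 2)) (binom-2 n) ⟨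
    2 * binom n 2 + n + n + 6 + 3 * (q + 2)  ≡⟨ ring₂ (binom n 2) n (3 * (q + 2)) ⟩
    2 * ((1 + n + binom n 2) + 2) + 3 * (q + 2) ≡⟨ cong (λ a → 2 * (a + 2) + 3 * (q + 2)) ball-3 ⟨
    2 * (ball n 3 + 2) + 3 * (q + 2)         ∎))
  where
  open ≤-Reasoning
  n : ℕ
  n = q + suc q
  ball-3 : ball n 3 ≡ 1 + n + binom n 2
  ball-3 = trans (ball-suc n 2) (cong (_+ binom n 2) (trans (ball-suc n 1)
    (cong₂ _+_ (trans (ball-suc n 0) (cong (_+ 1) (ball-0 n))) (binom-1 n))))
  ring₀ : ∀ b q → 2 * (3 * b) + 3 * q ≡ 3 * (2 * b + q)
  ring₀ = solve-∀
  ring₁ : ∀ q → 3 * ((q + 2) * (q + 2)) + q * q + 2 ≡ (q + suc q) * (q + suc q) + (q + suc q) + 6 + 3 * (q + 2) + 3 * q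
  ring₁ = solve-∀
  ring₂ : ∀ b n c → 2 * b + n + n + 6 + c ≡ 2 * ((1 + n + b) + 2) + c
  ring₂ = solve-∀
... | inj₁ 3≤t with m≤n⇒∃[o]m+o≡n 3≤t
...   | i , refl with m≤n⇒∃[o]m+o≡n t<q
...     | j , refl = ≤-trans (small i j) (≤-trans top-two (m≤m+n _ 2))
  where
  n : ℕ
  n = (4 + i + j) + suc (4 + i + j)
  top-two : binom n (2 + i) + binom n (3 + i) ≤ ball n (4 + i)
  top-two = ≤-trans (+-monoˡ-≤ (binom n (3 + i)) (m≤n+m _ (ball n (2 + i))))
    (≤-reflexive (sym (trans (ball-suc n (3 + i)) (cong (_+ binom n (3 + i)) (ball-suc n (2 + i))))))
  small : ∀ i j → 3 * binom ((4 + i + j) + (3 + i)) (3 + i) ≤ binom (suc ((4 + i + j) + suc (4 + i + j))) (3 + i)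
  -- This is q = 4, t = 3, where 105 ≤ 120 is evaluated.
  small zero    zero    = ≤ᵇ⇒≤ _ _ tt
  small zero    (suc j) = triple-binom zero (suc j) (s≤s z≤n)
  small (suc i) j       = triple-binom (suc i) j (s≤s z≤n)

-- The bounds for odd and even dimension

half-bound : ∀ k m X → k * 2 ≤ 2 ^ m * 2 + X → k ≤ 2 ^ m + X / 2
half-bound k m X le = begin
  k                       ≡⟨ m*n/n≡m k 2 ⟨
  k * 2 / 2               ≤⟨ /-monoˡ-≤ 2 le ⟩
  (2 ^ m * 2 + X) / 2     ≡⟨ +-distrib-/-∣ˡ X (n∣m*n (2 ^ m)) ⟩
  2 ^ m * 2 / 2 + X / 2   ≡⟨ cong (_+ X / 2) (m*n/n≡m (2 ^ m) 2) ⟩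
  2 ^ m + X / 2           ∎ where open ≤-Reasoning

-- For large `f`, strictness gives `suc k ≤ 2 ^ m + B`; doubling adds 2 on the left, which absorbs
-- the 2 allowed in `B * 2 ≤ X + 2`.
dichotomy-bound : ∀ {n p k} m X B → n ≡ suc m → (D : Dichotomy n p k) →
  (X < # (Dichotomy.f D) → # (Dichotomy.g D) < 2 ^ m + B) → B * 2 ≤ X + 2 → k ≤ 2 ^ m + X / 2
dichotomy-bound {k = k} m X B refl D small 2B≤X+2 = half-bound k m X doubled
  where
  open Dichotomy D
  open ≤-Reasoning
  doubled : k * 2 ≤ 2 ^ m * 2 + X
  doubled with X <? # f
  ... | no  X≮#f = ≤-trans k*2≤2ⁿ+f (+-mono-≤ (≤-reflexive (*-comm 2 (2 ^ m))) (≮⇒≥ X≮#f))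
  ... | yes X<#f = +-cancelʳ-≤ 2 _ _ (begin
    k * 2 + 2              ≡⟨ +-comm (k * 2) 2 ⟩
    suc k * 2              ≤⟨ *-monoˡ-≤ 2 (≤-trans (s≤s k≤#g) (small X<#f)) ⟩
    (2 ^ m + B) * 2        ≡⟨ *-distribʳ-+ 2 (2 ^ m) B ⟩
    2 ^ m * 2 + B * 2      ≤⟨ +-monoʳ-≤ (2 ^ m * 2) 2B≤X+2 ⟩
    2 ^ m * 2 + (X + 2)    ≡⟨ +-assoc (2 ^ m * 2) X 2 ⟨
    2 ^ m * 2 + X + 2      ∎)

∸-transfer : ∀ {a b c} → a + b ≤ c → a ≤ c ∸ b
∸-transfer {a} {b} {c} le = ≤-trans (≤-reflexive (sym (m+n∸n≡m a b))) (∸-monoˡ-≤ b le)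

double≤∸+2 : ∀ s R → 3 * s ≤ R + 2 → s * 2 ≤ (R ∸ s) + 2
double≤∸+2 s R le = ≤-trans (∸-transfer (≤-trans (≤-reflexive (ring s)) le)) (∸-shift s)
  where
  ring : ∀ s → s * 2 + s ≡ 3 * s
  ring = solve-∀
  ∸-shift : ∀ s → R + 2 ∸ s ≤ R ∸ s + 2
  ∸-shift s = m≤n+o⇒m∸n≤o (R + 2) s (≤-trans (+-monoˡ-≤ 2 (m≤n+m∸n R s)) (≤-reflexive (+-assoc s _ 2)))

cascade-diag : ∀ m k → cascade m m k ≡ binom (suc m) k
cascade-diag m zero    = refl
cascade-diag m (suc k) = +-comm (binom m (suc k)) _

ball-2 : ∀ n → ball n 2 ≡ 1 + n
ball-2 n = trans (ball-suc n 1) (cong₂ _+_ (trans (ball-suc n 0) (cong (_+ 1) (ball-0 n))) (binom-1 n))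

-- The cascade is left open because it must serve two ends: reach `s` at level `t`, yet stay within
-- half of `X + 2` at level `q`. No single choice does so for all `t`.
odd-bound-via : ∀ q τ m x k → let n = q + suc q ; t = suc τ ; s = binom (q + t) t ; X = ball n (suc t) ∸ s in
  t ≤ q → q ≤ suc m → q ≤ suc x → s ≤ cascade m x t → cascade m x q * 2 ≤ X + 2 →
  (c : Subset n → Fin k) → IsBColoring (QPow n (q + t)) k c → k ≤ 2 ^ (q + q) + X / 2
odd-bound-via q τ m x k t≤q q≤m q≤x s≤ 2B≤ c bc = dichotomy-bound (q + q) X (cascade m x q) (+-suc q q) D small 2B≤
  where
  n t s R X : ℕ
  n = q + suc q
  t = suc τ
  s = binom (q + t) t
  R = ball n (suc t)
  X = R ∸ s
  D : Dichotomy n (q + t) k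
  D = dichotomy c bc
  open Dichotomy D
  s≤C : s ≤ binom n t
  s≤C = binom-mono t (+-monoʳ-≤ q (m≤n⇒m≤1+n t≤q))
  small : X < # f → # g < 2 ^ (q + q) + cascade m x q
  small X<#f = ≤-trans
    (cross-bound q (suc q) τ m x X f g t≤q q≤m q≤x
      (subst (λ d → Cross d f g) (+-comm (suc q) t) cross)
      (∸-transfer (≤-trans (+-monoʳ-≤ (ball n t) s≤C) (≤-reflexive (sym (ball-suc n t)))))
      (≤-trans (m≤n+m∸n R s) (≤-trans (≤-reflexive (+-comm s X)) (+-monoʳ-≤ X s≤))) X<#f)
    (≤-reflexive (cong (_+ cascade m x q) (ball-half q)))

odd-bound : ∀ q t k → let n = q + suc q in 1 ≤ t → t < q →
  (c : Subset n → Fin k) → IsBColoring (QPow n (q + t)) k c →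
  k ≤ 2 ^ (q + q) + (ball n (suc t) ∸ binom (q + t) t) / 2
-- For t = 1 a one-term cascade is too weak; but two distinct q-sets already cover q + 1 points.
odd-bound (suc x) (suc zero) k _ (s≤s 1≤x) = odd-bound-via q 0 q x k (s≤s z≤n) (n≤1+n q) ≤-refl
  (≤-reflexive (trans (binom-1 (q + 1)) (sym (cong (_+ 1) (binom-1 q)))))
  (≤-trans (≤-reflexive (cong (_* 2) (cong₂ _+_ (binom-nn q) (binom-nn x))))
    (+-monoˡ-≤ 2 (∸-transfer {2} {binom (q + 1) 1} 2+s≤)))
  where
  open ≤-Reasoning
  q : ℕ
  q = suc x
  2+s≤ : 2 + binom (q + 1) 1 ≤ ball (q + suc q) 2
  2+s≤ = begin
    2 + binom (q + 1) 1   ≡⟨ cong (2 +_) (binom-1 (q + 1)) ⟩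
    2 + (q + 1)           ≤⟨ linear _ _ 1 1≤x (ring x) ⟩
    1 + (q + suc q)       ≡⟨ ball-2 (q + suc q) ⟨
    ball (q + suc q) 2    ∎
    where
    ring : ∀ x → 2 + (suc x + 1) + x + 1 ≡ 1 + (suc x + suc (suc x)) + 1
    ring = solve-∀
-- With equal parameters the cascade is the single binomial of top `q + t`, which is `s` at level
-- `t` and, by symmetry, at level `q`.
odd-bound q (suc τ@(suc _)) k _ t<q = odd-bound-via q τ m m k (<⇒≤ t<q) q≤m q≤m
  (≤-reflexive (trans (cong (λ i → binom i t) (+-suc q τ)) (sym (cascade-diag m t))))
  (≤-trans (≤-reflexive (cong (_* 2) B≡s)) (double≤∸+2 s _ (3binom≤ball+2 q t (s≤s (s≤s z≤n)) t<q)))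
  where
  m t s : ℕ
  m = q + τ
  t = suc τ
  s = binom (q + t) t
  q≤m : q ≤ suc m
  q≤m = m≤n⇒m≤1+n (m≤m+n q τ)
  B≡s : cascade m m q ≡ s
  B≡s = trans (cascade-diag m q) (trans (cong (λ i → binom i q) (sym (+-suc q τ))) (binom-sym q t))

even-bound : ∀ q t k → let n = suc q + suc q in 1 ≤ t → t < q →
  (c : Subset n → Fin k) → IsBColoring (QPow n (suc (q + t))) k c →
  k ≤ 2 ^ (q + suc q) + ((ball n (suc t) + binom (q + suc q) t) ∸ binom (q + t) t) / 2
even-bound q t k 1≤t t<q c bc = dichotomy-bound n′ X s refl D small (double≤∸+2 s R (3s≤R+2 t 1≤t t<q))
  where
  n′ n s R X : ℕ
  n′ = q + suc q
  n = suc n′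
  s = binom (q + t) t
  R = ball n (suc t) + binom n′ t
  X = R ∸ s
  D : Dichotomy n (suc (q + t)) k
  D = dichotomy c bc
  open Dichotomy D
  open ≤-Reasoning
  3s≤R+2 : ∀ t → 1 ≤ t → t < q → 3 * binom (q + t) t ≤ ball n (suc t) + binom n′ t + 2
  3s≤R+2 (suc zero) _ _ = begin
    3 * binom (q + 1) 1       ≡⟨ cong (3 *_) (binom-1 (q + 1)) ⟩
    3 * (q + 1)               ≤⟨ linear _ _ 3 (z≤n {q}) (ring q) ⟩
    1 + suc n′ + n′ + 2       ≡⟨ cong₂ (λ a b → a + b + 2) (ball-2 n) (binom-1 n′) ⟨
    ball n 2 + binom n′ 1 + 2 ∎
    where
    ring : ∀ q → 3 * (q + 1) + q + 3 ≡ 1 + suc (q + suc q) + (q + suc q) + 2 + 0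
    ring = solve-∀
  -- The ball in the even cube includes a copy of the ball in the odd cube, to which the odd
  -- estimate applies.
  3s≤R+2 t@(suc (suc _)) _ t<q = ≤-trans (3binom≤ball+2 q t (s≤s (s≤s z≤n)) t<q)
    (+-monoˡ-≤ 2 (≤-trans (m≤n+m _ (ball n′ t)) (m≤m+n (ball n (suc t)) _)))
  large : ball n (suc (suc t)) ≤ X + cascade n′ (q + t) (suc t)
  large = begin
    ball n (suc (suc t))                                  ≡⟨ ball-suc n (suc t) ⟩
    ball n (suc t) + (binom n′ t + binom n′ (suc t))      ≡⟨ +-assoc (ball n (suc t)) _ _ ⟨
    R + binom n′ (suc t)                                  ≤⟨ +-monoˡ-≤ _ (m≤n+m∸n R s) ⟩
    s + X + binom n′ (suc t)                              ≡⟨ ring s X _ ⟩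
    X + (binom n′ (suc t) + s)                            ∎
    where
    ring : ∀ a b c → a + b + c ≡ b + (c + a)
    ring = solve-∀
  small : X < # f → # g < 2 ^ n′ + s
  small X<#f = ≤-trans
    -- Here p + 1 is `suc t + suc q`, so `f` contains all sets of size up to `t`, one level more
    -- than in the odd case.
    (cross-bound (suc q) (suc q) t n′ (q + t) X f g (m≤n⇒m≤1+n t<q) (s≤s (m≤m+n q _)) (s≤s (m≤m+n q t))
      (subst (λ d → Cross d f g) (trans (cong (λ i → suc (suc i)) (+-comm q t)) (cong suc (sym (+-suc t q)))) cross)
      (∸-transfer (+-monoʳ-≤ (ball n (suc t)) (binom-mono t (+-monoʳ-≤ q (m≤n⇒m≤1+n (<⇒≤ t<q))))))
      large X<#f)
    (≤-reflexive (trans (sym (+-assoc (ball n (suc q)) _ _))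
      (cong₂ _+_ (ball-middle q) (binom-sym q t))))

-- Passing to the stated parameters

private
  n/2 : ∀ {n} q → n ≡ q * 2 → n / 2 ≡ q
  n/2 q refl = m*n/n≡m q 2

  q+q≡q*2 : ∀ q → q + q ≡ q * 2
  q+q≡q*2 = solve-∀

  q+[1+q]+1≡[1+q]*2 : ∀ q → q + suc q + 1 ≡ suc q * 2
  q+[1+q]+1≡[1+q]*2 = solve-∀

  exceeds : ∀ a {p} → suc a ≤ p → ∃ λ o → p ≡ a + suc o
  exceeds a le with m≤n⇒∃[o]m+o≡n le
  ... | o , refl = o , sym (+-suc a o)

odd-case : ∀ q p → let n = q + suc q in 2 ≤ n → (n + 1) / 2 ≤ p → p ≤ n ∸ 2 → bChromatic≤ (QPow n p)
  (2 ^ (n ∸ 1) + ((Σ0to (p ∸ (n ∸ 1) / 2) (λ i → n C i) ∸ p C (p ∸ (n ∸ 1) / 2)) / 2))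
odd-case q p 2≤n lo hi k c bc
  with exceeds q (≤-trans (≤-reflexive (sym (n/2 (suc q) (q+[1+q]+1≡[1+q]*2 q)))) lo)
... | o , refl = ≤-trans (odd-bound q t k (s≤s z≤n) t<q c bc) (≤-reflexive
  (cong₂ (λ a X → 2 ^ a + X / 2) (sym (cong (_∸ 1) (+-suc q q)))
    (trans (cong₂ _∸_ (sym (Σ0to≡ball n t)) (sym (C≡binom (q + t) t)))
      (cong (λ t → Σ0to t (n C_) ∸ (q + suc o) C t) (sym t≡)))))
  where
  n t : ℕ
  n = q + suc q
  t = suc o
  t≡ : q + t ∸ (n ∸ 1) / 2 ≡ t
  t≡ = trans (cong (q + t ∸_) (n/2 q (trans (cong (_∸ 1) (+-suc q q)) (q+q≡q*2 q)))) (m+n∸m≡n q t)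
  t<q : t < q
  t<q = s≤s⁻¹ (≤-trans (≤-reflexive (+-comm 2 t))
    (+-cancelˡ-≤ q _ _ (≤-trans (≤-reflexive (sym (+-assoc q t 2)))
      (≤-trans (+-monoˡ-≤ 2 hi) (≤-reflexive (m∸n+n≡m 2≤n))))))

even-case : ∀ q p → let n = suc q + suc q in n / 2 + 1 ≤ p → p ≤ n ∸ 2 → bChromatic≤ (QPow n p)
  (2 ^ (n ∸ 1) + (((Σ0to (p ∸ n / 2) (λ i → n C i) + (n ∸ 1) C (p ∸ n / 2)) ∸ (p ∸ 1) C (p ∸ n / 2)) / 2))
even-case q p lo hi k c bc
  with exceeds (suc q) (≤-trans (≤-reflexive (trans (+-comm 1 (suc q))
         (cong (_+ 1) (sym (n/2 (suc q) (q+q≡q*2 (suc q))))))) lo)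
... | o , refl = ≤-trans (even-bound q t k (s≤s z≤n) t<q c bc) (≤-reflexive
  (cong (λ X → 2 ^ (q + suc q) + X / 2)
    (trans (cong₂ _∸_ (cong₂ _+_ (sym (Σ0to≡ball n t)) (sym (C≡binom (q + suc q) t))) (sym (C≡binom (q + t) t)))
      (cong (λ t → (Σ0to t (n C_) + (n ∸ 1) C t) ∸ (q + suc o) C t) (sym t≡)))))
  where
  n t : ℕ
  n = suc q + suc q
  t = suc o
  t≡ : suc q + t ∸ n / 2 ≡ t
  t≡ = trans (cong (suc q + t ∸_) (n/2 (suc q) (q+q≡q*2 (suc q)))) (m+n∸m≡n q t)
  t<q : t < q
  t<q = +-cancelˡ-≤ q _ _ (≤-trans (≤-reflexive (+-suc q t)) (≤-trans hi (≤-reflexive (cong (_∸ 1) (+-suc q q)))))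

odd-form : ∀ n → n % 2 ≡ 1 → ∃ λ q → n ≡ q + suc q
odd-form n n%2 = n / 2 , trans (m≡m%n+[m/n]*n n 2) (trans (cong (_+ n / 2 * 2) n%2) (ring (n / 2)))
  where
  ring : ∀ q → 1 + q * 2 ≡ q + suc q
  ring = solve-∀

even-form : ∀ n → n % 2 ≡ 0 → ∃ λ q → n ≡ q + q
even-form n n%2 = n / 2 , trans (m≡m%n+[m/n]*n n 2) (trans (cong (_+ n / 2 * 2) n%2) (sym (q+q≡q*2 (n / 2))))

theorem4p6 :
    (∀ (n p : ℕ) → 5 ≤ n → n % 2 ≡ 1 → (n + 1) / 2 ≤ p → p ≤ n ∸ 2 →
      bChromatic≤ (QPow n p)
        (2 ^ (n ∸ 1) + ((Σ0to (p ∸ (n ∸ 1) / 2) (λ i → n C i) ∸ p C (p ∸ (n ∸ 1) / 2)) / 2)))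
    ×
    (∀ (n p : ℕ) → 6 ≤ n → n % 2 ≡ 0 → n / 2 + 1 ≤ p → p ≤ n ∸ 2 →
      bChromatic≤ (QPow n p)
        (2 ^ (n ∸ 1) + (((Σ0to (p ∸ n / 2) (λ i → n C i) + (n ∸ 1) C (p ∸ n / 2)) ∸ (p ∸ 1) C (p ∸ n / 2)) / 2)))
theorem4p6 = odd , even
  where
  odd : _
  odd n p 5≤n n%2 with odd-form n n%2
  ... | q , refl = odd-case q p (≤-trans (s≤s (s≤s z≤n)) 5≤n)
  even : _
  even n p 6≤n n%2 with even-form n n%2
  ... | suc q , refl = even-case q p
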